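{- For all integers $k \ge 2$, $$ z(k^2+k+1-h) \leq \begin{cases} k^3+2k^2 & \text{for } h=1,\\ k^3+2k^2-2k & \text{for } h=2,\\ k^3+2k^2-4k+1 & \text{for } h=3. \end{cases} $$
   Context: For a nonnegative integer $n$, $z(n)$ denotes the Zarankiewicz number $z(n,n;2,2)$: the maximum number of edges in a subgraph of the complete bipartite graph $K_{n,n}$ that does not contain $K_{2,2}=C_4$ (the 4-cycle) as a subgraph (not necessarily induced). Equivalently, $z(n)$ is the maximum number of 1's in an $n\times n$ 0-1 matrix with no $2\times 2$ submatrix (rows and columns not necessarily consecutive) consisting entirely of 1's. -}

module Defs where

open import Data.Bool.Base using (true; false)
open import Data.Fin.Base using (Fin)
open import Data.Fin.Properties using (_≟_; any?)
open import Data.Fin.Subset using (Subset; _∈_; ∣_∣; ⊥)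
open import Data.Fin.Subset.Properties using (_∈?_; ∉⊥)
open import Data.List.Base using (List; []; _∷_; cartesianProductWith; filter)
open import Data.List.Extrema.Nat using (argmax; argmax-all; f[xs]≤f[argmax])
import Data.List.Membership.Propositional as List
open import Data.List.Membership.Propositional.Properties using (∈-cartesianProductWith⁺; ∈-filter⁺)
open import Data.List.Relation.Unary.All as All using ()
open import Data.List.Relation.Unary.All.Properties using (all-filter)
open import Data.List.Relation.Unary.Any using (here; there)
open import Data.Nat.Base using (ℕ; zero; suc; _≤_)
open import Data.Product.Base using (_×_; _,_; ∃-syntax)
open import Data.Vec.Base as Vec using (Vec; []; _∷_; lookup; replicate)
open import Data.Vec.Properties using (lookup-replicate)
open import Relation.Binary.PropositionalEquality using (_≡_; _≢_; refl; subst)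
open import Relation.Nullary using (¬_; Dec; ¬?; _×-dec_)

-- A subgraph of K_{n,n} is given by the neighbourhoods, among the n right
-- vertices, of its n left vertices.  Since Subset n is Vec Bool n, this is
-- also an n × n 0-1 matrix.
Subgraph : ℕ → Set
Subgraph n = Vec (Subset n) n

Edge : ∀ {n} → Subgraph n → Fin n → Fin n → Set
Edge G u v = v ∈ lookup G u

edges : ∀ {n} → Subgraph n → ℕ
edges G = Vec.sum (Vec.map ∣_∣ G)

-- A 4-cycle in a bipartite graph has two vertices on each side.
ContainsC₄ : ∀ {n} → Subgraph n → Set
ContainsC₄ G = ∃[ u ] ∃[ u′ ] ∃[ v ] ∃[ v′ ]
  (u ≢ u′ × v ≢ v′ × Edge G u v × Edge G u v′ × Edge G u′ v × Edge G u′ v′)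

C₄-Free : ∀ {n} → Subgraph n → Set
C₄-Free G = ¬ ContainsC₄ G

C₄-free? : ∀ {n} (G : Subgraph n) → Dec (C₄-Free G)
C₄-free? G = ¬? (any? λ u → any? λ u′ → any? λ v → any? λ v′ →
  ¬? (u ≟ u′) ×-dec ¬? (v ≟ v′) ×-dec
  (v ∈? lookup G u) ×-dec (v′ ∈? lookup G u) ×-dec
  (v ∈? lookup G u′) ×-dec (v′ ∈? lookup G u′))

allVecs : ∀ {A : Set} → List A → (n : ℕ) → List (Vec A n)
allVecs xs zero    = [] ∷ []
allVecs xs (suc n) = cartesianProductWith _∷_ xs (allVecs xs n)

allSubgraphs : (n : ℕ) → List (Subgraph n)
allSubgraphs n = allVecs (allVecs (true ∷ false ∷ []) n) n

edgeless : (n : ℕ) → Subgraph n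
edgeless n = replicate n ⊥

extremal : (n : ℕ) → Subgraph n
extremal n = argmax edges (edgeless n) (filter C₄-free? (allSubgraphs n))

-- The Zarankiewicz number z(n,n;2,2).  The edgeless graph, which is C₄-free,
-- is only the starting value of argmax; z-attained and z-upper below show
-- that z n is the maximum of edges over all C₄-free subgraphs of K_{n,n}.
z : ℕ → ℕ
z n = edges (extremal n)

∈-allVecs : ∀ {A : Set} {xs : List A} → (∀ x → x List.∈ xs) →
            ∀ {n} (v : Vec A n) → v List.∈ allVecs xs n
∈-allVecs full []      = here refl
∈-allVecs full (x ∷ v) = ∈-cartesianProductWith⁺ _∷_ (full x) (∈-allVecs full v)

∈-allSubgraphs : ∀ {n} (G : Subgraph n) → G List.∈ allSubgraphs n
∈-allSubgraphs = ∈-allVecs (∈-allVecs λ { true → here refl ; false → there (here refl) })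

edgeless-C₄-free : ∀ n → C₄-Free (edgeless n)
edgeless-C₄-free n (u , _ , v , _ , _ , _ , uv , _) =
  ∉⊥ (subst (v ∈_) (lookup-replicate u ⊥) uv)

z-attained : ∀ n → ∃[ G ] (C₄-Free {n} G × edges G ≡ z n)
z-attained n = extremal n , free , refl
  where
  free : C₄-Free (extremal n)
  free = argmax-all edges {P = C₄-Free} {⊥ = edgeless n}
    (edgeless-C₄-free n) (all-filter C₄-free? (allSubgraphs n))

z-upper : ∀ {n} (G : Subgraph n) → C₄-Free G → edges G ≤ z n
z-upper {n} G free =
  All.lookup (f[xs]≤f[argmax] (edgeless n) (filter C₄-free? (allSubgraphs n)))
             (∈-filter⁺ C₄-free? (∈-allSubgraphs G) free)

{-# OPTIONS --safe #-}
-- Call the left vertices points and the right vertices lines, and let n = k² + k + 1 - h.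
-- Measure a point by its deficiency a = k + 1 - degree, a line by b = k + 1 - size, and put
-- c = Σ a = Σ b = (k + 1) n - edges.  If the claimed bound fails then c ≤ h k - h - ε, where
-- ε = 0, 0, 1 for h = 1, 2, 3.  A point p is non-collinear with exactly -h + k a(p) + Σ_{L ∋ p} b(L)
-- other points, so there are (2k + 1) c - h n - Σ b² non-collinear ordered pairs; dually for lines.
--
-- If all a ≥ 0, weigh the non-collinear pairs (p , q) with a(p) ≥ 1 by 1 - a(q).  A line with b ≤ 0
-- has total point deficiency at least h - k b, which makes most points collinear with p deficient,
-- and the two counts contradict each other.  The dual argument applies if all b ≥ 0.
--
-- If b(L) < 0, then every point off L with a ≥ 0 misses a point of L.  This gives about 2k²
-- non-collinear pairs, which is too many for h ≤ 2, and for h = 3 forces b(L) = -1 and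
-- 2β ≤ k² - 15k + 28, where β is the number of long lines.  If α ≥ 1 points also have a = -1, then
-- each point with a = 0 must miss a point on each of the long lines not through it; applied once with
-- a single long line and once with all of them, together with the duals, this forces α + β to
-- be both at least of order k² and at most of order k.
module Submission where

open import Defs
open import Data.Bool.Base using (Bool; true; false)
open import Data.Empty using (⊥; ⊥-elim)
open import Data.Fin.Base using (Fin; zero; suc)
open import Data.Fin.Properties using (_≟_; any?; suc-injective)
open import Data.Fin.Subset using (Subset; ∣_∣)
open import Data.List.Base using (List; []; _∷_)
open import Data.Nat.Base using (ℕ; zero; suc; z≤n; s≤s)
import Data.Nat.Base as ℕ
import Data.Nat.Properties as ℕ
open import Data.Product.Base using (_×_; _,_; proj₁; proj₂)
open import Data.Sum.Base using (_⊎_; inj₁; inj₂)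
open import Data.Vec.Base as Vec using (Vec; []; _∷_; lookup)
open import Data.Vec.Properties using (lookup⇒[]=)
open import Function.Base using (flip; _∘_)
open import Relation.Binary.PropositionalEquality using (_≡_; _≢_; refl; sym; trans; cong; cong₂; subst; module ≡-Reasoning)
open import Relation.Nullary using (¬_; yes; no)

module _ where
  open import Data.Integer.Base using (ℤ; +_; -[1+_]; +≤+; 0ℤ; 1ℤ; _+_; _*_; _-_; -_; _≤_)
  open import Data.Integer.Properties using (+-*-semiring; +-mono-≤; *-comm; *-identityˡ; *-identityʳ; *-zeroˡ; *-zeroʳ; +-identityˡ; +-identityʳ; ≤-refl; ≤-reflexive; ≤-antisym; i≤j⇒0≤j-i; 0≤i-j⇒j≤i; pos-*; _≤?_; ⊖-≥; m-n≡m⊖n; drop‿+≤+)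
  open import Data.Integer.Tactic.RingSolver using (solve-∀)
  open import Algebra.Properties.Semiring.Sum +-*-semiring using (sum; sum-cong-≗; ∑-distrib-+; ∑-comm; *-distribˡ-sum)

  -- Finite sums of integers

  -- A linear combination kept as a list of coefficients and functions. `sum-lin` then reduces an
  -- identity between sums to a ring identity at each index; the many `1ℤ *` and `+ 0ℤ` below are
  -- traces of this format.
  comb : ∀ {n} → List (ℤ × (Fin n → ℤ)) → Fin n → ℤ
  comb []            i = 0ℤ
  comb ((c , f) ∷ l) i = c * f i + comb l i

  comb-map : ∀ {n} → ((Fin n → ℤ) → ℤ) → List (ℤ × (Fin n → ℤ)) → ℤ
  comb-map φ []            = 0ℤ
  comb-map φ ((c , f) ∷ l) = c * φ f + comb-map φ l

  sum-zero : ∀ n → sum {n} (λ _ → 0ℤ) ≡ 0ℤ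
  sum-zero zero    = refl
  sum-zero (suc n) = trans (+-identityˡ _) (sum-zero n)

  sum-one : ∀ n → sum {n} (λ _ → 1ℤ) ≡ + n
  sum-one zero    = refl
  sum-one (suc n) = cong (_+_ 1ℤ) (sum-one n)

  sum-comb : ∀ {n} (l : List (ℤ × (Fin n → ℤ))) → sum (comb l) ≡ comb-map sum l
  sum-comb {n} []      = sum-zero n
  sum-comb ((c , f) ∷ l) = begin
    sum (λ i → c * f i + comb l i)          ≡⟨ ∑-distrib-+ (λ i → c * f i) (comb l) ⟩
    sum (λ i → c * f i) + sum (comb l)      ≡⟨ cong₂ _+_ (sym (*-distribˡ-sum c f)) (sum-comb l) ⟩
    c * sum f + comb-map sum l              ∎
    where open ≡-Reasoning

  sum-lin : ∀ {n} (l : List (ℤ × (Fin n → ℤ))) {f : Fin n → ℤ} → (∀ i → f i ≡ comb l i) → sum f ≡ comb-map sum l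
  sum-lin l eq = trans (sum-cong-≗ eq) (sum-comb l)

  sum-nonneg : ∀ {n} (f : Fin n → ℤ) → (∀ i → 0ℤ ≤ f i) → 0ℤ ≤ sum f
  sum-nonneg {zero}  f 0≤f = ≤-refl
  sum-nonneg {suc n} f 0≤f = +-mono-≤ (0≤f zero) (sum-nonneg (f ∘ suc) (0≤f ∘ suc))

  comb-nonneg : ∀ {n} (l : List (ℤ × (Fin n → ℤ))) → (∀ i → 0ℤ ≤ comb l i) → 0ℤ ≤ comb-map sum l
  comb-nonneg l 0≤l = subst (0ℤ ≤_) (sum-comb l) (sum-nonneg (comb l) 0≤l)

  δ : ∀ {n} → Fin n → Fin n → ℤ
  δ zero    zero    = 1ℤ
  δ zero    (suc j) = 0ℤ
  δ (suc i) zero    = 0ℤ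
  δ (suc i) (suc j) = δ i j

  δ-refl : ∀ {n} (i : Fin n) → δ i i ≡ 1ℤ
  δ-refl zero    = refl
  δ-refl (suc i) = δ-refl i

  δ-≢ : ∀ {n} {i j : Fin n} → i ≢ j → δ i j ≡ 0ℤ
  δ-≢ {i = zero}  {zero}  i≢j = ⊥-elim (i≢j refl)
  δ-≢ {i = zero}  {suc j} i≢j = refl
  δ-≢ {i = suc i} {zero}  i≢j = refl
  δ-≢ {i = suc i} {suc j} i≢j = δ-≢ (i≢j ∘ cong suc)

  sum-δ : ∀ {n} (i : Fin n) (f : Fin n → ℤ) → sum (λ j → δ i j * f j) ≡ f i
  sum-δ {suc n} zero f = begin
    1ℤ * f zero + sum (λ j → 0ℤ * f (suc j))  ≡⟨ cong₂ _+_ (*-identityˡ (f zero)) (trans (sum-cong-≗ λ j → *-zeroˡ (f (suc j))) (sum-zero n)) ⟩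
    f zero + 0ℤ                               ≡⟨ +-identityʳ (f zero) ⟩
    f zero                                    ∎
    where open ≡-Reasoning
  sum-δ (suc i) f = begin
    0ℤ * f zero + sum (λ j → δ i j * f (suc j))  ≡⟨ cong₂ _+_ (*-zeroˡ (f zero)) (sum-δ i (f ∘ suc)) ⟩
    0ℤ + f (suc i)                               ≡⟨ +-identityˡ (f (suc i)) ⟩
    f (suc i)                                    ∎
    where open ≡-Reasoning

  Bit : ℤ → Set
  Bit x = x ≡ 0ℤ ⊎ x ≡ 1ℤ

  sum-≤1 : ∀ {n} (f : Fin n → ℤ) → (∀ i → Bit (f i)) → (∀ i j → f i ≡ 1ℤ → f j ≡ 1ℤ → i ≡ j) → sum f ≤ 1ℤ
  sum-≤1 {zero}  f bit unique = +≤+ z≤n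
  sum-≤1 {suc n} f bit unique with bit zero
  ... | inj₁ f₀≡0 = subst (_≤ 1ℤ) (sym (trans (cong (_+ sum (f ∘ suc)) f₀≡0) (+-identityˡ _)))
                      (sum-≤1 (f ∘ suc) (bit ∘ suc) λ i j p q → suc-injective (unique (suc i) (suc j) p q))
  ... | inj₂ f₀≡1 = ≤-reflexive (trans (cong₂ _+_ f₀≡1 (trans (sum-cong-≗ rest≡0) (sum-zero n))) refl)
    where
    rest≡0 : ∀ i → f (suc i) ≡ 0ℤ
    rest≡0 i with bit (suc i)
    ... | inj₁ fᵢ≡0 = fᵢ≡0
    ... | inj₂ fᵢ≡1 with unique zero (suc i) f₀≡1 fᵢ≡1
    ...   | ()

  -- Incidence matrices

  module Incidence {n : ℕ} (x : Fin n → Fin n → ℤ) where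

    -- The incidence operator, taking functions on lines to functions on points. At `flip x` the
    -- module yields its transpose `Nᵀ` and the dual notions for lines.
    N : (Fin n → ℤ) → Fin n → ℤ
    N g p = sum (λ L → x p L * g L)

    deg : Fin n → ℤ
    deg = N (λ _ → 1ℤ)

    -- For a matrix without 4-cycles, D p q is 1 if p and q are distinct and lie
    -- on no common line, and 0 otherwise.
    D : Fin n → Fin n → ℤ
    D p q = 1ℤ - N (x q) p + δ p q * (deg p - 1ℤ)

    D* : (Fin n → ℤ) → Fin n → ℤ
    D* f p = sum (λ q → D p q * f q)

    N-lin : ∀ l {g} → (∀ L → g L ≡ comb l L) → ∀ p → N g p ≡ comb-map (λ f → N f p) l
    N-lin l {g} eq p = trans (sum-cong-≗ (λ L → cong (x p L *_) (eq L))) (go l)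
      where
      go : ∀ l → N (comb l) p ≡ comb-map (λ f → N f p) l
      go [] = trans (sum-cong-≗ λ L → *-zeroʳ (x p L)) (sum-zero n)
      go ((c , f) ∷ l) = trans
        (sum-lin ((c , λ L → x p L * f L) ∷ (1ℤ , λ L → x p L * comb l L) ∷ []) (λ L → ring (x p L) c (f L) (comb l L)))
        (trans (ring′ (c * N f p) (N (comb l) p)) (cong (λ u → c * N f p + u) (go l)))
        where
        ring : ∀ x c f g → x * (c * f + g) ≡ c * (x * f) + (1ℤ * (x * g) + 0ℤ)
        ring = solve-∀
        ring′ : ∀ u v → u + (1ℤ * v + 0ℤ) ≡ u + v
        ring′ = solve-∀

    N-δ : ∀ L p → N (δ L) p ≡ x p L
    N-δ L p = trans (sum-cong-≗ (λ M → *-comm (x p M) (δ L M))) (sum-δ L (x p))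

  module _ {n : ℕ} (x : Fin n → Fin n → ℤ) where
    open Incidence x
    open Incidence (flip x) using () renaming (N to Nᵀ)

    -- Double counting of flags: `N` and `Nᵀ` are adjoint.
    sum-N : ∀ f g → sum (λ p → f p * N g p) ≡ sum (λ L → g L * Nᵀ f L)
    sum-N f g = begin
      sum (λ p → f p * N g p)                     ≡⟨ sum-cong-≗ (λ p → *-distribˡ-sum (f p) (λ L → x p L * g L)) ⟩
      sum (λ p → sum λ L → f p * (x p L * g L))   ≡⟨ ∑-comm (λ p L → f p * (x p L * g L)) ⟩
      sum (λ L → sum λ p → f p * (x p L * g L))   ≡⟨ sum-cong-≗ (λ L → trans (sum-cong-≗ λ p → ring (f p) (x p L) (g L)) (sym (*-distribˡ-sum (g L) (λ p → x p L * f p)))) ⟩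
      sum (λ L → g L * Nᵀ f L)                    ∎
      where
      open ≡-Reasoning
      ring : ∀ f x g → f * (x * g) ≡ g * (x * f)
      ring = solve-∀

    -- As a matrix, `D` is the all-ones matrix minus `N Nᵀ` plus the diagonal matrix with entries
    -- `deg p - 1ℤ`.
    D*-NNᵀ : ∀ f p → D* f p ≡ sum f - N (Nᵀ f) p + (deg p - 1ℤ) * f p
    D*-NNᵀ f p = begin
      D* f p
        ≡⟨ sum-lin ((1ℤ , f) ∷ (- 1ℤ , λ q → f q * N (x q) p) ∷ (deg p - 1ℤ , λ q → δ p q * f q) ∷ [])
                   (λ q → ring (N (x q) p) (δ p q) (deg p) (f q)) ⟩
      1ℤ * sum f + (- 1ℤ * sum (λ q → f q * N (x q) p) + ((deg p - 1ℤ) * sum (λ q → δ p q * f q) + 0ℤ))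
        ≡⟨ cong₂ (λ u v → 1ℤ * sum f + (- 1ℤ * u + ((deg p - 1ℤ) * v + 0ℤ))) swap (sum-δ p f) ⟩
      1ℤ * sum f + (- 1ℤ * N (Nᵀ f) p + ((deg p - 1ℤ) * f p + 0ℤ))
        ≡⟨ ring′ (sum f) (N (Nᵀ f) p) ((deg p - 1ℤ) * f p) ⟩
      sum f - N (Nᵀ f) p + (deg p - 1ℤ) * f p ∎
      where
      open ≡-Reasoning
      ring : ∀ N δ d f → (1ℤ - N + δ * (d - 1ℤ)) * f ≡ 1ℤ * f + (- 1ℤ * (f * N) + ((d - 1ℤ) * (δ * f) + 0ℤ))
      ring = solve-∀
      ring′ : ∀ u v w → 1ℤ * u + (- 1ℤ * v + (w + 0ℤ)) ≡ u - v + w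
      ring′ = solve-∀
      swap : sum (λ q → f q * N (x q) p) ≡ N (Nᵀ f) p
      swap = trans (sum-cong-≗ λ q → cong (f q *_) (sum-cong-≗ λ L → *-comm (x p L) (x q L))) (sum-N f (x p))

  module _ {n : ℕ} (x : Fin n → Fin n → ℤ) where
    open Incidence x
    open Incidence (flip x) using () renaming (N to Nᵀ; deg to size; D* to Dᵀ*)

    -- After expanding `D` and its dual by `D*-NNᵀ`, the terms `N Nᵀ N` cancel. In a matrix without
    -- 4-cycles and for `g = δ L` the meaning is that a point off `L` is non-collinear with as many
    -- points of `L` as there are lines through it missing `L`, plus `size L - deg p`.
    D*-N : ∀ g p → D* (N g) p ≡ N (Dᵀ* g) p + sum (λ L → (1ℤ - x p L) * g L * (size L - deg p))
    D*-N g p = begin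
      D* (N g) p
        ≡⟨ D*-NNᵀ x (N g) p ⟩
      sum (N g) - N (Nᵀ (N g)) p + (deg p - 1ℤ) * N g p
        ≡⟨ cong (λ u → u - N (Nᵀ (N g)) p + (deg p - 1ℤ) * N g p) ∑N ⟩
      sum (λ L → g L * size L) - N (Nᵀ (N g)) p + (deg p - 1ℤ) * N g p
        ≡⟨ ring (sum g) (deg p) (N (Nᵀ (N g)) p) (N (λ L → size L * g L) p) (N g p) (sum (λ L → g L * size L)) ⟩
      (sum g * deg p + (- 1ℤ * N (Nᵀ (N g)) p + (1ℤ * N (λ L → size L * g L) p + (- 1ℤ * N g p + 0ℤ))))
        + (1ℤ * sum (λ L → g L * size L) + (- deg p * sum g + (- 1ℤ * N (λ L → size L * g L) p + (deg p * N g p + 0ℤ))))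
        ≡⟨ cong₂ _+_
            (sym (N-lin ((sum g , λ _ → 1ℤ) ∷ (- 1ℤ , Nᵀ (N g)) ∷ (1ℤ , λ L → size L * g L) ∷ (- 1ℤ , g) ∷ [])
                        (λ L → trans (D*-NNᵀ (flip x) g L) (ring₁ (sum g) (Nᵀ (N g) L) (size L) (g L))) p))
            (sym (sum-lin ((1ℤ , λ L → g L * size L) ∷ (- deg p , g) ∷ (- 1ℤ , λ L → x p L * (size L * g L)) ∷ (deg p , λ L → x p L * g L) ∷ [])
                          (λ L → ring₂ (x p L) (g L) (size L) (deg p)))) ⟩
      N (Dᵀ* g) p + sum (λ L → (1ℤ - x p L) * g L * (size L - deg p)) ∎
      where
      open ≡-Reasoning
      ∑N : sum (N g) ≡ sum (λ L → g L * size L)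
      ∑N = trans (sum-cong-≗ λ q → sym (*-identityˡ (N g q))) (sum-N x (λ _ → 1ℤ) g)
      ring : ∀ G d M S Ng T → T - M + (d - 1ℤ) * Ng ≡ (G * d + (- 1ℤ * M + (1ℤ * S + (- 1ℤ * Ng + 0ℤ)))) + (1ℤ * T + (- d * G + (- 1ℤ * S + (d * Ng + 0ℤ))))
      ring = solve-∀
      ring₁ : ∀ G M s g → G - M + (s - 1ℤ) * g ≡ G * 1ℤ + (- 1ℤ * M + (1ℤ * (s * g) + (- 1ℤ * g + 0ℤ)))
      ring₁ = solve-∀
      ring₂ : ∀ x g s d → (1ℤ - x) * g * (s - d) ≡ 1ℤ * (g * s) + (- d * g + (- 1ℤ * (x * (s * g)) + (d * (x * g) + 0ℤ)))
      ring₂ = solve-∀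

  -- Nonnegative integers

  -- Inequalities are proved by certificates: `_⊕_` and `_⊗_` assemble a nonnegative expression from
  -- known ones, and `by` carries it along a ring identity to the required form. A contradiction is
  -- a certificate for `- 1ℤ`.
  by : ∀ {i j} → i ≡ j → 0ℤ ≤ i → 0ℤ ≤ j
  by = subst (0ℤ ≤_)

  infixl 6 _⊕_
  infixl 7 _⊗_

  _⊕_ : ∀ {i j} → 0ℤ ≤ i → 0ℤ ≤ j → 0ℤ ≤ i + j
  _⊕_ = +-mono-≤

  _⊗_ : ∀ {i j} → 0ℤ ≤ i → 0ℤ ≤ j → 0ℤ ≤ i * j
  _⊗_ {+ m} {+ n} _ _ = subst (0ℤ ≤_) (pos-* m n) (+≤+ z≤n)

  0≤+ : ∀ n → 0ℤ ≤ + n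
  0≤+ n = +≤+ z≤n

  ¬0≤-1 : ¬ (0ℤ ≤ - 1ℤ)
  ¬0≤-1 ()

  0≤∨≤-1 : ∀ i → 0ℤ ≤ i ⊎ 0ℤ ≤ - 1ℤ - i
  0≤∨≤-1 (+ n)    = inj₁ (0≤+ n)
  0≤∨≤-1 -[1+ n ] = inj₂ (0≤+ n)

  -- The negative part. On deficiencies that are at least `- 1ℤ` it is the indicator of `- 1ℤ`.
  neg : ℤ → ℤ
  neg (+ n)    = 0ℤ
  neg -[1+ n ] = + suc n

  0≤neg : ∀ i → 0ℤ ≤ neg i
  0≤neg (+ n)    = 0≤+ 0
  0≤neg -[1+ n ] = 0≤+ _

  0≤i+neg : ∀ i → 0ℤ ≤ i + neg i
  0≤i+neg (+ n)    = by (sym (+-identityʳ (+ n))) (0≤+ n)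
  0≤i+neg -[1+ n ] = ≤-reflexive (ring (+ suc n))
    where
    ring : ∀ i → 0ℤ ≡ - i + i
    ring = solve-∀

  -- Here |i| = i + 2 neg i.
  i+2neg≤i² : ∀ i → 0ℤ ≤ i * i - i - + 2 * neg i
  i+2neg≤i² (+ 0)     = 0≤+ 0
  i+2neg≤i² (+ suc n) = by (ring (+ n)) (0≤+ n ⊗ (0≤+ n ⊕ 0≤+ 1))
    where
    ring : ∀ n → n * (n + 1ℤ) ≡ (1ℤ + n) * (1ℤ + n) - (1ℤ + n) - + 2 * 0ℤ
    ring = solve-∀
  i+2neg≤i² -[1+ n ]  = by (ring (+ n)) (0≤+ n ⊗ (0≤+ n ⊕ 0≤+ 1))
    where
    ring : ∀ n → n * (n + 1ℤ) ≡ - (1ℤ + n) * - (1ℤ + n) - - (1ℤ + n) - + 2 * (1ℤ + n)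
    ring = solve-∀

  term≤sum : ∀ {n} (f : Fin n → ℤ) → (∀ i → 0ℤ ≤ f i) → ∀ i → 0ℤ ≤ sum f - f i
  term≤sum {suc n} f 0≤f zero    = by (ring (f zero) (sum (f ∘ suc))) (sum-nonneg (f ∘ suc) (0≤f ∘ suc))
    where
    ring : ∀ u v → v ≡ u + v - u
    ring = solve-∀
  term≤sum {suc n} f 0≤f (suc i) = by (ring (f zero) (sum (f ∘ suc)) (f (suc i))) (0≤f zero ⊕ term≤sum (f ∘ suc) (0≤f ∘ suc) i)
    where
    ring : ∀ u v w → u + (v - w) ≡ u + v - w
    ring = solve-∀

  bit-nonneg : ∀ {i} → Bit i → 0ℤ ≤ i
  bit-nonneg (inj₁ refl) = 0≤+ 0
  bit-nonneg (inj₂ refl) = 0≤+ 1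

  bit-≤1 : ∀ {i} → Bit i → 0ℤ ≤ 1ℤ - i
  bit-≤1 (inj₁ refl) = 0≤+ 1
  bit-≤1 (inj₂ refl) = 0≤+ 0

  -- Incidence matrices without 4-cycles

  record Linear {n : ℕ} (x : Fin n → Fin n → ℤ) : Set where
    field
      bit  : ∀ p L → Bit (x p L)
      free : ∀ {p q L M} → p ≢ q → L ≢ M → x p L ≡ 1ℤ → x p M ≡ 1ℤ → x q L ≡ 1ℤ → x q M ≡ 1ℤ → ⊥

  -- A 4-cycle is symmetric in rows and columns, so each count for points has a dual for lines.
  dual : ∀ {n} {x : Fin n → Fin n → ℤ} → Linear x → Linear (flip x)
  dual lin = record
    { bit  = λ L p → bit p L
    ; free = λ L≢M p≢q Lp Lq Mp Mq → free p≢q L≢M Lp Mp Lq Mq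
    }
    where open Linear lin

  module NonCollinearity {n : ℕ} {x : Fin n → Fin n → ℤ} (lin : Linear x) where
    open Incidence x
    open Linear lin

    bit-product : ∀ {i j} → Bit i → Bit j → Bit (i * j) × (i * j ≡ 1ℤ → i ≡ 1ℤ × j ≡ 1ℤ)
    bit-product (inj₁ refl) (inj₁ refl) = inj₁ refl , λ ()
    bit-product (inj₁ refl) (inj₂ refl) = inj₁ refl , λ ()
    bit-product (inj₂ refl) (inj₁ refl) = inj₁ refl , λ ()
    bit-product (inj₂ refl) (inj₂ refl) = inj₂ refl , λ _ → refl , refl

    D-refl : ∀ p → D p p ≡ 0ℤ
    D-refl p = trans (cong₂ (λ u v → 1ℤ - u + v * (deg p - 1ℤ)) (sum-cong-≗ λ L → idem (bit p L)) (δ-refl p)) (ring (deg p))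
      where
      ring : ∀ d → 1ℤ - d + 1ℤ * (d - 1ℤ) ≡ 0ℤ
      ring = solve-∀
      idem : ∀ {i} → Bit i → i * i ≡ i * 1ℤ
      idem (inj₁ refl) = refl
      idem (inj₂ refl) = refl

    D-≢ : ∀ {p q} → p ≢ q → D p q ≡ 1ℤ - N (x q) p
    D-≢ {p} {q} p≢q = trans (cong (λ u → 1ℤ - N (x q) p + u * (deg p - 1ℤ)) (δ-≢ p≢q)) (ring (N (x q) p) (deg p))
      where
      ring : ∀ u d → 1ℤ - u + 0ℤ * (d - 1ℤ) ≡ 1ℤ - u
      ring = solve-∀

    common≥0 : ∀ p q L → 0ℤ ≤ x p L * x q L
    common≥0 p q L = bit-nonneg (bit p L) ⊗ bit-nonneg (bit q L)

    -- Two distinct points on two common lines would form a 4-cycle, so `N (x q) p` is at most 1 off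
    -- the diagonal.
    D-nonneg : ∀ p q → 0ℤ ≤ D p q
    D-nonneg p q with p ≟ q
    ... | yes refl = ≤-reflexive (sym (D-refl p))
    ... | no p≢q  = by (sym (D-≢ p≢q)) (i≤j⇒0≤j-i (sum-≤1 (λ L → x p L * x q L)
                      (λ L → proj₁ (bit-product (bit p L) (bit q L))) unique))
      where
      unique : ∀ L M → x p L * x q L ≡ 1ℤ → x p M * x q M ≡ 1ℤ → L ≡ M
      unique L M e f with L ≟ M
      ... | yes L≡M = L≡M
      ... | no L≢M  with proj₂ (bit-product (bit p L) (bit q L)) e | proj₂ (bit-product (bit p M) (bit q M)) f
      ...   | pL , qL | pM , qM = ⊥-elim (free p≢q L≢M pL pM qL qM)

    D-≤1 : ∀ p q → 0ℤ ≤ 1ℤ - D p q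
    D-≤1 p q with p ≟ q
    ... | yes refl = by (cong (λ u → 1ℤ - u) (sym (D-refl p))) (0≤+ 1)
    ... | no p≢q  = by (trans (ring (N (x q) p)) (cong (λ u → 1ℤ - u) (sym (D-≢ p≢q)))) (sum-nonneg _ (common≥0 p q))
      where
      ring : ∀ u → u ≡ 1ℤ - (1ℤ - u)
      ring = solve-∀

    D-sym : ∀ p q → D p q ≡ D q p
    D-sym p q with p ≟ q
    ... | yes refl = refl
    ... | no p≢q  = trans (D-≢ p≢q) (trans (cong (λ u → 1ℤ - u) (sum-cong-≗ λ L → *-comm (x p L) (x q L))) (sym (D-≢ (p≢q ∘ sym))))

    D-collinear : ∀ p q L → x p L ≡ 1ℤ → x q L ≡ 1ℤ → D p q ≡ 0ℤ
    D-collinear p q L pL qL with p ≟ q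
    ... | yes refl = D-refl p
    ... | no p≢q  = ≤-antisym (0≤i-j⇒j≤i (by eq (term≤sum (λ M → x p M * x q M) (common≥0 p q) L))) (D-nonneg p q)
      where
      ring : ∀ u → u - 1ℤ ≡ 0ℤ - (1ℤ - u)
      ring = solve-∀
      eq : N (x q) p - x p L * x q L ≡ 0ℤ - D p q
      eq = trans (cong (λ u → N (x q) p - u) (cong₂ _*_ pL qL)) (trans (ring (N (x q) p)) (cong (λ u → 0ℤ - u) (sym (D-≢ p≢q))))

    D*-nonneg : ∀ {f} → (∀ q → 0ℤ ≤ f q) → ∀ p → 0ℤ ≤ D* f p
    D*-nonneg 0≤f p = sum-nonneg _ (λ q → D-nonneg p q ⊗ 0≤f q)

    sum-D* : ∀ f g → sum (λ p → f p * D* g p) ≡ sum (λ q → g q * D* f q)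
    sum-D* f g = begin
      sum (λ p → f p * D* g p)                   ≡⟨ sum-cong-≗ (λ p → *-distribˡ-sum (f p) (λ q → D p q * g q)) ⟩
      sum (λ p → sum λ q → f p * (D p q * g q))  ≡⟨ ∑-comm (λ p q → f p * (D p q * g q)) ⟩
      sum (λ q → sum λ p → f p * (D p q * g q))  ≡⟨ sum-cong-≗ (λ q → trans (sum-cong-≗ λ p → trans (cong (λ u → f p * (u * g q)) (D-sym p q)) (ring (f p) (D q p) (g q)))
                                                                        (sym (*-distribˡ-sum (g q) (λ p → D q p * f p)))) ⟩
      sum (λ q → g q * D* f q)                   ∎
      where
      open ≡-Reasoning
      ring : ∀ f d g → f * (d * g) ≡ g * (d * f)
      ring = solve-∀

    D*-δ : ∀ q p → D* (δ q) p ≡ D p q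
    D*-δ q p = trans (sum-cong-≗ λ r → *-comm (D p r) (δ q r)) (sum-δ q (D p))

    -- No pair counted by D lies on L, so the pairs that meet L are counted twice in the total.
    line-bound : ∀ L → 0ℤ ≤ sum (D* (λ _ → 1ℤ)) - + 2 * sum (D* (λ q → x q L))
    line-bound L = by eq (sum-nonneg _ λ p → sum-nonneg _ λ q → pair p q (bit p L) (bit q L))
      where
      u : Fin n → ℤ
      u q = x q L
      pair : ∀ p q → Bit (u p) → Bit (u q) → 0ℤ ≤ D p q * (1ℤ - u p - u q)
      pair p q (inj₁ e) bq = by (cong (λ v → D p q * (v - u q)) (cong (λ v → 1ℤ - v) (sym e))) (D-nonneg p q ⊗ bit-≤1 bq)
      pair p q (inj₂ e) (inj₁ f) = by (cong₂ (λ v w → D p q * (1ℤ - v - w)) (sym e) (sym f)) (D-nonneg p q ⊗ 0≤+ 0)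
      pair p q (inj₂ e) (inj₂ f) = ≤-reflexive (sym (trans (cong (_* (1ℤ - u p - u q)) (D-collinear p q L e f)) (*-zeroˡ (1ℤ - u p - u q))))
      ring : ∀ d u v → d * (1ℤ - u - v) ≡ (1ℤ - u) * (d * 1ℤ) + (- 1ℤ * (d * v) + 0ℤ)
      ring = solve-∀
      ring₁ : ∀ u A B → (1ℤ - u) * A + (- 1ℤ * B + 0ℤ) ≡ 1ℤ * A + (- 1ℤ * (u * A) + (- 1ℤ * B + 0ℤ))
      ring₁ = solve-∀
      ring₂ : ∀ A B → 1ℤ * A + (- 1ℤ * B + (- 1ℤ * B + 0ℤ)) ≡ A - + 2 * B
      ring₂ = solve-∀
      one : Fin n → ℤ
      one _ = 1ℤ
      eq : sum (λ p → sum λ q → D p q * (1ℤ - u p - u q)) ≡ sum (D* one) - + 2 * sum (D* u)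
      eq = trans
        (sum-lin ((1ℤ , D* one) ∷ (- 1ℤ , λ p → u p * D* one p) ∷ (- 1ℤ , D* u) ∷ [])
          (λ p → trans (sum-lin ((1ℤ - u p , λ q → D p q * 1ℤ) ∷ (- 1ℤ , λ q → D p q * u q) ∷ []) (λ q → ring (D p q) (u p) (u q)))
                       (ring₁ (u p) (D* one p) (D* u p))))
        (trans (cong (λ v → 1ℤ * sum (D* one) + (- 1ℤ * v + (- 1ℤ * sum (D* u) + 0ℤ)))
                     (trans (sum-D* u one) (sum-cong-≗ λ q → *-identityˡ (D* u q))))
               (ring₂ (sum (D* one)) (sum (D* u))))

  0≤i⇒neg≡0 : ∀ i → 0ℤ ≤ i → neg i ≡ 0ℤ
  0≤i⇒neg≡0 (+ n) _ = refl

  i≤-1⇒neg≡-i : ∀ i → 0ℤ ≤ - 1ℤ - i → neg i ≡ - i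
  i≤-1⇒neg≡-i (+ zero)  ()
  i≤-1⇒neg≡-i (+ suc n) ()
  i≤-1⇒neg≡-i -[1+ n ]  _ = refl

  one : ∀ {n} → Fin n → ℤ
  one _ = 1ℤ

  -- Deficiencies with respect to a projective plane of order k

  module Deficiency {n : ℕ} (x : Fin n → Fin n → ℤ) (k h : ℤ) (order : + n ≡ k * k + k + 1ℤ - h) where
    open Incidence x
    open Incidence (flip x) using () renaming (N to Nᵀ; deg to size)

    a b r : Fin n → ℤ
    a p = k + 1ℤ - deg p
    b L = k + 1ℤ - size L
    r = N b

    size-b : ∀ L → size L ≡ k + 1ℤ - b L
    size-b L = ring k (size L)
      where
      ring : ∀ k z → z ≡ k + 1ℤ - (k + 1ℤ - z)
      ring = solve-∀

    -- Both sides are `(k + 1ℤ) * + n` minus the number of flags.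
    sum-b : sum b ≡ sum a
    sum-b = trans (expand size) (trans (cong (λ u → (k + 1ℤ) * sum {n} one + (- 1ℤ * u + 0ℤ)) (sym flags)) (sym (expand deg)))
      where
      ring : ∀ k z → k + 1ℤ - z ≡ (k + 1ℤ) * 1ℤ + (- 1ℤ * z + 0ℤ)
      ring = solve-∀
      expand : ∀ f → sum (λ i → k + 1ℤ - f i) ≡ (k + 1ℤ) * sum {n} one + (- 1ℤ * sum f + 0ℤ)
      expand f = sum-lin ((k + 1ℤ , one) ∷ (- 1ℤ , f) ∷ []) (λ i → ring k (f i))
      flags : sum deg ≡ sum size
      flags = trans (sum-cong-≗ λ p → sym (*-identityˡ (deg p))) (trans (sum-N x one one) (sum-cong-≗ λ L → *-identityˡ (size L)))

    -- Each line through `p` joins it to `size L - 1ℤ` other points. When these are subtracted from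
    -- `+ n - 1ℤ` and sizes and degrees are written through `b` and `a`, the terms of a projective
    -- plane cancel.
    D-row : ∀ p → D* one p ≡ - h + k * a p + r p
    D-row p = begin
      D* one p
        ≡⟨ D*-NNᵀ x one p ⟩
      sum {n} one - N size p + (deg p - 1ℤ) * 1ℤ
        ≡⟨ cong₂ (λ u v → u - v + (deg p - 1ℤ) * 1ℤ) (trans (sum-one n) order)
                 (N-lin ((k + 1ℤ , one) ∷ (- 1ℤ , b) ∷ []) (λ L → trans (size-b L) (ring k (b L))) p) ⟩
      k * k + k + 1ℤ - h - ((k + 1ℤ) * deg p + (- 1ℤ * r p + 0ℤ)) + (deg p - 1ℤ) * 1ℤ
        ≡⟨ ring′ k h (deg p) (r p) ⟩
      - h + k * a p + r p ∎
      where
      open ≡-Reasoning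
      ring : ∀ k b → k + 1ℤ - b ≡ (k + 1ℤ) * 1ℤ + (- 1ℤ * b + 0ℤ)
      ring = solve-∀
      ring′ : ∀ k h d r → k * k + k + 1ℤ - h - ((k + 1ℤ) * d + (- 1ℤ * r + 0ℤ)) + (d - 1ℤ) * 1ℤ ≡ - h + k * (k + 1ℤ - d) + r
      ring′ = solve-∀

    sum-N1 : ∀ g → sum (N g) ≡ sum (λ L → g L * size L)
    sum-N1 g = trans (sum-cong-≗ λ p → sym (*-identityˡ (N g p))) (sum-N x one g)

    -- Summation over flags gives each line the weight `b L * size L`; the square arises from
    -- `size L` being `k + 1ℤ - b L`.
    sum-r : sum r ≡ (k + 1ℤ) * sum a - sum (λ L → b L * b L)
    sum-r = begin
      sum r
        ≡⟨ sum-N1 b ⟩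
      sum (λ L → b L * size L)
        ≡⟨ sum-lin ((k + 1ℤ , b) ∷ (- 1ℤ , λ L → b L * b L) ∷ []) (λ L → trans (cong (b L *_) (size-b L)) (ring k (b L))) ⟩
      (k + 1ℤ) * sum b + (- 1ℤ * sum (λ L → b L * b L) + 0ℤ)
        ≡⟨ trans (cong (λ u → (k + 1ℤ) * u + (- 1ℤ * sum (λ L → b L * b L) + 0ℤ)) sum-b) (ring′ ((k + 1ℤ) * sum a) (sum (λ L → b L * b L))) ⟩
      (k + 1ℤ) * sum a - sum (λ L → b L * b L) ∎
      where
      open ≡-Reasoning
      ring : ∀ k b → b * (k + 1ℤ - b) ≡ (k + 1ℤ) * b + (- 1ℤ * (b * b) + 0ℤ)
      ring = solve-∀
      ring′ : ∀ u v → u + (- 1ℤ * v + 0ℤ) ≡ u - v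
      ring′ = solve-∀

    sum-D : sum (D* one) ≡ (+ 2 * k + 1ℤ) * sum a - h * + n - sum (λ L → b L * b L)
    sum-D = begin
      sum (D* one)
        ≡⟨ sum-lin ((- h , one) ∷ (k , a) ∷ (1ℤ , r) ∷ []) (λ p → trans (D-row p) (ring h k (a p) (r p))) ⟩
      - h * sum {n} one + (k * sum a + (1ℤ * sum r + 0ℤ))
        ≡⟨ cong₂ (λ u v → - h * u + (k * sum a + (1ℤ * v + 0ℤ))) (sum-one n) sum-r ⟩
      - h * + n + (k * sum a + (1ℤ * ((k + 1ℤ) * sum a - sum (λ L → b L * b L)) + 0ℤ))
        ≡⟨ ring′ h (+ n) k (sum a) (sum (λ L → b L * b L)) ⟩
      (+ 2 * k + 1ℤ) * sum a - h * + n - sum (λ L → b L * b L) ∎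
      where
      open ≡-Reasoning
      ring : ∀ h k a r → - h + k * a + r ≡ - h * 1ℤ + (k * a + (1ℤ * r + 0ℤ))
      ring = solve-∀
      ring′ : ∀ h n k c y → - h * n + (k * c + (1ℤ * ((k + 1ℤ) * c - y) + 0ℤ)) ≡ (+ 2 * k + 1ℤ) * c - h * n - y
      ring′ = solve-∀

    -b≤sum-neg : ∀ L → 0ℤ ≤ - 1ℤ - b L → 0ℤ ≤ sum (λ M → neg (b M)) - - b L
    -b≤sum-neg L b<0 = by (cong (λ u → sum (λ M → neg (b M)) - u) (i≤-1⇒neg≡-i (b L) b<0)) (term≤sum (λ M → neg (b M)) (λ M → 0≤neg (b M)) L)

  pos : ℤ → ℤ
  pos (+ suc n) = 1ℤ
  pos _         = 0ℤ

  pos-bit : ∀ i → Bit (pos i)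
  pos-bit (+ zero)  = inj₁ refl
  pos-bit (+ suc n) = inj₂ refl
  pos-bit -[1+ n ]  = inj₁ refl

  -- A view tying an integer to the value of its indicator, so that one match fixes both. `Sign₋₁`
  -- adds `neg`, for integers that are at least `- 1ℤ`.
  data Sign : ℤ → ℤ → Set where
    zero     : Sign 0ℤ 0ℤ
    positive : ∀ n → Sign (+ suc n) 1ℤ

  sign : ∀ i → 0ℤ ≤ i → Sign i (pos i)
  sign (+ zero)  _ = zero
  sign (+ suc n) _ = positive n

  data Sign₋₁ : ℤ → ℤ → ℤ → Set where
    minus-one : Sign₋₁ (- 1ℤ) 0ℤ 1ℤ
    zero      : Sign₋₁ 0ℤ 0ℤ 0ℤ
    positive  : ∀ n → Sign₋₁ (+ suc n) 1ℤ 0ℤ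

  sign₋₁ : ∀ i → 0ℤ ≤ i + 1ℤ → Sign₋₁ i (pos i) (neg i)
  sign₋₁ (+ zero)     _ = zero
  sign₋₁ (+ suc n)    _ = positive n
  sign₋₁ -[1+ zero ]  _ = minus-one
  sign₋₁ -[1+ suc n ] ()

  -- Counting non-collinear pairs

  module Plane {n : ℕ} {x : Fin n → Fin n → ℤ} (lin : Linear x) (k h : ℤ) (order : + n ≡ k * k + k + 1ℤ - h)
               (2≤k : 0ℤ ≤ k - + 2) where
    open Incidence x
    open Incidence (flip x) using () renaming (N to Nᵀ; deg to size; D to Dᵀ; D* to Dᵀ*)
    open NonCollinearity lin
    open NonCollinearity (dual lin) using () renaming (D-nonneg to Dᵀ-nonneg; D-≤1 to Dᵀ-≤1; D-refl to Dᵀ-refl; D-sym to Dᵀ-sym; D*-δ to Dᵀ*-δ; D*-nonneg to Dᵀ*-nonneg)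
    open Linear lin
    open Deficiency x k h order
    open Deficiency (flip x) k h order using () renaming (r to s; D-row to Dᵀ-row)

    D-row-nonneg : ∀ p → 0ℤ ≤ - h + k * a p + r p
    D-row-nonneg p = by (D-row p) (D*-nonneg (λ _ → 0≤+ 1) p)

    Dᵀ-row-nonneg : ∀ L → 0ℤ ≤ - h + k * b L + s L
    Dᵀ-row-nonneg L = by (Dᵀ-row L) (Dᵀ*-nonneg (λ _ → 0≤+ 1) L)

    -- `sum-D` counts pairs and so is nonnegative; one square is at most the sum of all squares.
    b²-bound : ∀ L → 0ℤ ≤ (+ 2 * k + 1ℤ) * sum a - h * + n - b L * b L
    b²-bound L = by (trans (cong (λ u → u + (Y - b L * b L)) sum-D) (ring ((+ 2 * k + 1ℤ) * sum a - h * + n) Y (b L * b L)))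
                    (sum-nonneg _ (D*-nonneg (λ _ → 0≤+ 1)) ⊕ term≤sum (λ M → b M * b M) (λ M → square (b M)) L)
      where
      Y = sum (λ M → b M * b M)
      ring : ∀ t y z → t - y + (y - z) ≡ t - z
      ring = solve-∀
      square : ∀ i → 0ℤ ≤ i * i
      square (+ i)    = 0≤+ i ⊗ 0≤+ i
      square -[1+ i ] = 0≤+ _

    -- A line with more than k + 1 points

    module LongLine (L : Fin n) (b<0 : 0ℤ ≤ - 1ℤ - b L) where
      u v : Fin n → ℤ
      u p = x p L
      v = Dᵀ* (δ L)

      -- Here `u` is the indicator of `L` and `v` that of the lines disjoint from `L`. This is
      -- `D*-N` at `δ L` summed over all points; a point off `L` contributes `size L - deg p`, which
      -- is `a p - b L`.
      sum-D*u : sum (D* u) ≡ sum (λ M → v M * size M) + (sum a - s L) - b L * (+ n - size L)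
      sum-D*u = begin
        sum (D* u)
          ≡⟨ sum-lin ((1ℤ , N v) ∷ (1ℤ , a) ∷ (- 1ℤ , λ p → x p L * a p) ∷ (- b L , one) ∷ (b L , λ p → x p L * 1ℤ) ∷ []) point ⟩
        1ℤ * sum (N v) + (1ℤ * sum a + (- 1ℤ * s L + (- b L * sum {n} one + (b L * size L + 0ℤ))))
          ≡⟨ cong₂ (λ w z → 1ℤ * w + (1ℤ * sum a + (- 1ℤ * s L + (- b L * z + (b L * size L + 0ℤ))))) (sum-N1 v) (sum-one n) ⟩
        1ℤ * sum (λ M → v M * size M) + (1ℤ * sum a + (- 1ℤ * s L + (- b L * + n + (b L * size L + 0ℤ))))
          ≡⟨ ring (sum (λ M → v M * size M)) (sum a) (s L) (b L) (+ n) (size L) ⟩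
        sum (λ M → v M * size M) + (sum a - s L) - b L * (+ n - size L) ∎
        where
        open ≡-Reasoning
        ring : ∀ V c s b n z → 1ℤ * V + (1ℤ * c + (- 1ℤ * s + (- b * n + (b * z + 0ℤ)))) ≡ V + (c - s) - b * (n - z)
        ring = solve-∀
        ring₁ : ∀ x δ y → (1ℤ - x) * δ * y ≡ δ * ((1ℤ - x) * y)
        ring₁ = solve-∀
        ring₂ : ∀ V x k z d → V + (1ℤ - x) * (z - d) ≡
          1ℤ * V + (1ℤ * (k + 1ℤ - d) + (- 1ℤ * (x * (k + 1ℤ - d)) + (- (k + 1ℤ - z) * 1ℤ + ((k + 1ℤ - z) * (x * 1ℤ) + 0ℤ))))
        ring₂ = solve-∀
        point : ∀ p → D* u p ≡ 1ℤ * N v p + (1ℤ * a p + (- 1ℤ * (x p L * a p) + (- b L * 1ℤ + (b L * (x p L * 1ℤ) + 0ℤ))))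
        point p = begin
          D* u p
            ≡⟨ sum-cong-≗ (λ q → cong (D p q *_) (sym (N-δ L q))) ⟩
          D* (N (δ L)) p
            ≡⟨ D*-N x (δ L) p ⟩
          N v p + sum (λ M → (1ℤ - x p M) * δ L M * (size M - deg p))
            ≡⟨ cong (λ w → N v p + w) (trans (sum-cong-≗ λ M → ring₁ (x p M) (δ L M) (size M - deg p)) (sum-δ L (λ M → (1ℤ - x p M) * (size M - deg p)))) ⟩
          N v p + (1ℤ - x p L) * (size L - deg p)
            ≡⟨ ring₂ (N v p) (x p L) k (size L) (deg p) ⟩
          1ℤ * N v p + (1ℤ * a p + (- 1ℤ * (x p L * a p) + (- b L * 1ℤ + (b L * (x p L * 1ℤ) + 0ℤ)))) ∎

      sum-v : sum v ≡ - h + k * b L + s L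
      sum-v = trans (sum-cong-≗ λ M → trans (Dᵀ*-δ L M) (trans (Dᵀ-sym M L) (sym (*-identityʳ (Dᵀ L M))))) (Dᵀ-row L)

      -- The factor size M - 1 is negative on an empty line, which b M ² = (k + 1)² absorbs.
      weight : ∀ M → 0ℤ ≤ + 2 * (v M * size M) + (- + 2 * v M + (1ℤ * (b M * b M) + (- 1ℤ * b M + (- + 2 * neg (b M) + (- (b L * b L + b L) * (δ L M * 1ℤ) + 0ℤ)))))
      weight M with L ≟ M
      ... | yes refl = ≤-reflexive (trans (ring (size L) (b L))
              (sym (trans (cong₂ (λ w z → + 2 * (w * size L) + (- + 2 * w + (1ℤ * (b L * b L) + (- 1ℤ * b L + (- + 2 * z + (- (b L * b L + b L) * (δ L L * 1ℤ) + 0ℤ))))))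
                            (trans (Dᵀ*-δ L L) (Dᵀ-refl L)) (i≤-1⇒neg≡-i (b L) b<0))
                     (cong (λ w → + 2 * (0ℤ * size L) + (- + 2 * 0ℤ + (1ℤ * (b L * b L) + (- 1ℤ * b L + (- + 2 * - b L + (- (b L * b L + b L) * (w * 1ℤ) + 0ℤ)))))) (δ-refl L)))))
        where
        ring : ∀ z b → 0ℤ ≡ + 2 * (0ℤ * z) + (- + 2 * 0ℤ + (1ℤ * (b * b) + (- 1ℤ * b + (- + 2 * - b + (- (b * b + b) * (1ℤ * 1ℤ) + 0ℤ)))))
        ring = solve-∀
      ... | no L≢M with 0≤∨≤-1 (size M - 1ℤ)
      ...   | inj₁ 1≤z = by (trans (ring (v M) (size M) (b M) (neg (b M)) (b L * b L + b L))
                               (cong (λ w → + 2 * (v M * size M) + (- + 2 * v M + (1ℤ * (b M * b M) + (- 1ℤ * b M + (- + 2 * neg (b M) + (- (b L * b L + b L) * (w * 1ℤ) + 0ℤ)))))) (sym (δ-≢ L≢M))))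
                            (0≤+ 2 ⊗ (by (sym (Dᵀ*-δ L M)) (Dᵀ-nonneg M L) ⊗ 1≤z) ⊕ i+2neg≤i² (b M))
        where
        ring : ∀ v z b m w → + 2 * (v * (z - 1ℤ)) + (b * b - b - + 2 * m) ≡ + 2 * (v * z) + (- + 2 * v + (1ℤ * (b * b) + (- 1ℤ * b + (- + 2 * m + (- w * (0ℤ * 1ℤ) + 0ℤ)))))
        ring = solve-∀
      ...   | inj₂ z≤0 = by (trans (ring (v M) k (b L * b L + b L)) (trans
                               (cong₂ (λ z m → + 2 * (v M * z) + (- + 2 * v M + (1ℤ * ((k + 1ℤ - z) * (k + 1ℤ - z)) + (- 1ℤ * (k + 1ℤ - z) + (- + 2 * m + (- (b L * b L + b L) * (0ℤ * 1ℤ) + 0ℤ)))))) (sym z≡0) (sym neg≡0))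
                               (cong (λ w → + 2 * (v M * size M) + (- + 2 * v M + (1ℤ * (b M * b M) + (- 1ℤ * b M + (- + 2 * neg (b M) + (- (b L * b L + b L) * (w * 1ℤ) + 0ℤ)))))) (sym (δ-≢ L≢M)))))
                            (0≤+ 2 ⊗ by (cong (λ w → 1ℤ - w) (sym (Dᵀ*-δ L M))) (Dᵀ-≤1 M L) ⊕ (2≤k ⊕ 0≤+ 1) ⊗ (2≤k ⊕ 0≤+ 4))
        where
        ring : ∀ v k w → + 2 * (1ℤ - v) + (k - + 2 + 1ℤ) * (k - + 2 + + 4) ≡ + 2 * (v * 0ℤ) + (- + 2 * v + (1ℤ * ((k + 1ℤ - 0ℤ) * (k + 1ℤ - 0ℤ)) + (- 1ℤ * (k + 1ℤ - 0ℤ) + (- + 2 * 0ℤ + (- w * (0ℤ * 1ℤ) + 0ℤ)))))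
        ring = solve-∀
        0≤size : 0ℤ ≤ size M
        0≤size = sum-nonneg _ λ p → bit-nonneg (bit p M) ⊗ 0≤+ 1
        z≡0 : size M ≡ 0ℤ
        z≡0 = ≤-antisym (0≤i-j⇒j≤i (by (ring′ (size M)) z≤0)) 0≤size
          where
          ring′ : ∀ z → - 1ℤ - (z - 1ℤ) ≡ 0ℤ - z
          ring′ = solve-∀
        neg≡0 : neg (b M) ≡ 0ℤ
        neg≡0 = 0≤i⇒neg≡0 (b M) (by (trans (ring′ k) (cong (λ z → k + 1ℤ - z) (sym z≡0))) (2≤k ⊕ 0≤+ 3))
          where
          ring′ : ∀ k → k - + 2 + + 3 ≡ k + 1ℤ - 0ℤ
          ring′ = solve-∀

      -- `line-bound` compares `sum-D` with twice `sum-D*u`. Adding `weight` summed over all lines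
      -- cancels the sums of `b M * b M` and of `v M * size M`, and `sum-v` removes `s L`.
      long-line-bound : 0ℤ ≤ (+ 2 * k - + 2) * sum a - h * + n + + 2 * h - + 2 * k * b L + + 2 * b L * (+ n - (k + 1ℤ - b L))
                             - + 2 * sum (λ M → neg (b M)) - (b L * b L + b L)
      long-line-bound = combine (sum (λ M → v M * size M)) (sum (λ M → b M * b M)) (sum a) (sum (λ M → neg (b M))) (+ n) (s L) (b L) k h
        sum-D sum-D*u sum-v sum-b (size-b L) (sum-δ L one) (line-bound L)
        (comb-nonneg ((+ 2 , λ M → v M * size M) ∷ (- + 2 , v) ∷ (1ℤ , λ M → b M * b M) ∷ (- 1ℤ , b) ∷ (- + 2 , λ M → neg (b M)) ∷ (- (b L * b L + b L) , λ M → δ L M * 1ℤ) ∷ []) weight)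
        where
        combine : ∀ V Y c B n s b k h {S₁ S₂ W c′ z δ′} →
          S₁ ≡ (+ 2 * k + 1ℤ) * c - h * n - Y → S₂ ≡ V + (c - s) - b * (n - z) → W ≡ - h + k * b + s → c′ ≡ c → z ≡ k + 1ℤ - b → δ′ ≡ 1ℤ →
          0ℤ ≤ S₁ - + 2 * S₂ →
          0ℤ ≤ + 2 * V + (- + 2 * W + (1ℤ * Y + (- 1ℤ * c′ + (- + 2 * B + (- (b * b + b) * δ′ + 0ℤ))))) →
          0ℤ ≤ (+ 2 * k - + 2) * c - h * n + + 2 * h - + 2 * k * b + + 2 * b * (n - (k + 1ℤ - b)) - + 2 * B - (b * b + b)
        combine V Y c B n s b k h refl refl refl refl refl refl p q = by (ring V Y c B n s b k h) (p ⊕ q)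
          where
          ring : ∀ V Y c B n s b k h →
            ((+ 2 * k + 1ℤ) * c - h * n - Y) - + 2 * (V + (c - s) - b * (n - (k + 1ℤ - b))) + (+ 2 * V + (- + 2 * (- h + k * b + s) + (1ℤ * Y + (- 1ℤ * c + (- + 2 * B + (- (b * b + b) * 1ℤ + 0ℤ))))))
            ≡ (+ 2 * k - + 2) * c - h * n + + 2 * h - + 2 * k * b + + 2 * b * (n - (k + 1ℤ - b)) - + 2 * B - (b * b + b)
          ring = solve-∀

    sum-sq : 0ℤ ≤ sum (λ L → b L * b L) - sum a - + 2 * sum (λ L → neg (b L))
    sum-sq = by (trans (cong (λ u → 1ℤ * Y + (- 1ℤ * u + (- + 2 * β + 0ℤ))) sum-b) (ring Y (sum a) β))
                (comb-nonneg ((1ℤ , λ L → b L * b L) ∷ (- 1ℤ , b) ∷ (- + 2 , λ L → neg (b L)) ∷ [])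
                             (λ L → by (ring′ (b L) (neg (b L))) (i+2neg≤i² (b L))))
      where
      Y = sum (λ L → b L * b L)
      β = sum (λ L → neg (b L))
      ring : ∀ Y c β → 1ℤ * Y + (- 1ℤ * c + (- + 2 * β + 0ℤ)) ≡ Y - c - + 2 * β
      ring = solve-∀
      ring′ : ∀ b m → b * b - b - + 2 * m ≡ 1ℤ * (b * b) + (- 1ℤ * b + (- + 2 * m + 0ℤ))
      ring′ = solve-∀

    -- Nonnegative point deficiencies

    module NonnegativeDeficiency (0≤a : ∀ p → 0ℤ ≤ a p) (h≤3 : 0ℤ ≤ + 3 - h) where
      χ m : Fin n → ℤ
      χ p = pos (a p)
      m = Nᵀ χ

      X Y E : ℤ
      X = sum (λ p → a p * a p)
      Y = sum (λ L → b L * b L)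
      E = sum χ

      χ*a : ∀ p → χ p * a p ≡ a p
      χ*a p = go (sign (a p) (0≤a p))
        where
        go : ∀ {i j} → Sign i j → j * i ≡ i
        go zero         = refl
        go (positive n) = *-identityˡ (+ suc n)

      -- The weight `1ℤ - a q` is at most `1ℤ - χ q`, which is nonnegative. Hence the non-collinear
      -- pairs with `p` deficient, weighted by `1ℤ - a q`, total at most the number of non-collinear
      -- pairs with `a q` equal to 0.
      pair : ∀ p q → 0ℤ ≤ D p q * (1ℤ - χ q - χ p * (1ℤ - a q))
      pair p q = D-nonneg p q ⊗ go (sign (a q) (0≤a q)) (pos-bit (a p))
        where
        go : ∀ {i j c} → Sign i j → Bit c → 0ℤ ≤ 1ℤ - j - c * (1ℤ - i)
        go zero         (inj₁ refl) = 0≤+ 1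
        go zero         (inj₂ refl) = 0≤+ 0
        go (positive n) (inj₁ refl) = 0≤+ 0
        go (positive n) (inj₂ refl) = by (ring (+ n)) (0≤+ n)
          where
          ring : ∀ n → n ≡ 1ℤ - 1ℤ - 1ℤ * (1ℤ - (1ℤ + n))
          ring = solve-∀

      D*a : ∀ p → D* a p ≡ sum a - N s p + (k - a p) * a p
      D*a p = trans (D*-NNᵀ x a p) (ring (sum a) (N s p) (deg p) k)
        where
        ring : ∀ c t d k → c - t + (d - 1ℤ) * (k + 1ℤ - d) ≡ c - t + (k - (k + 1ℤ - d)) * (k + 1ℤ - d)
        ring = solve-∀

      -- The sum of `pair` over all `p` and `q`. Row sums come from `D-row` and `D*a`, symmetry of
      -- `D` turns the sum of `D* χ` into row sums weighted by `χ`, and `sum-N` moves the rest to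
      -- the lines, where `m L` is the number of deficient points on `L`.
      noncollinear-pairs : 0ℤ ≤ (k + 1ℤ) * sum a - h * + n - Y + (+ 2 * h + sum a) * E - X
                                - + 2 * sum (λ L → b L * m L) - sum (λ L → s L * m L)
      noncollinear-pairs = combine (sum a) (+ n) Y E X (sum (λ L → b L * m L)) (sum (λ L → s L * m L)) k h
          sum-D (sum-N x χ b) (sum-N x χ s)
          (by (trans (sum-cong-≗ outer) (sum-comb l)) (sum-nonneg _ λ p → sum-nonneg _ λ q → pair p q))
          (trans (sum-cong-≗ λ p → sym (*-identityˡ (D* χ p))) (trans (sum-D* one χ) (sum-lin l′ weighted)))
        where
        l l′ : List (ℤ × (Fin n → ℤ))
        l = (1ℤ , D* one) ∷ (- 1ℤ , D* χ) ∷ (h + sum a , χ) ∷ (- 1ℤ , λ p → χ p * r p) ∷ (- 1ℤ , λ p → χ p * N s p) ∷ (- 1ℤ , λ p → a p * a p) ∷ []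
        l′ = (- h , χ) ∷ (k , a) ∷ (1ℤ , λ p → χ p * r p) ∷ []
        inner : ∀ p → sum (λ q → D p q * (1ℤ - χ q - χ p * (1ℤ - a q))) ≡ (1ℤ - χ p) * D* one p + (- 1ℤ * D* χ p + (χ p * D* a p + 0ℤ))
        inner p = sum-lin ((1ℤ - χ p , λ q → D p q * 1ℤ) ∷ (- 1ℤ , λ q → D p q * χ q) ∷ (χ p , λ q → D p q * a q) ∷ []) (λ q → ring (D p q) (χ q) (χ p) (a q))
          where
          ring : ∀ d c e a → d * (1ℤ - c - e * (1ℤ - a)) ≡ (1ℤ - e) * (d * 1ℤ) + (- 1ℤ * (d * c) + (e * (d * a) + 0ℤ))
          ring = solve-∀
        outer : ∀ p → sum (λ q → D p q * (1ℤ - χ q - χ p * (1ℤ - a q))) ≡ comb l p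
        outer p = trans (inner p) (subst-rows (D* χ p) (χ p) (N s p) (r p) (a p) (sum a) k h (D-row p) (D*a p) (χ*a p))
          where
          subst-rows : ∀ w e t r a c k h {d d′} → d ≡ - h + k * a + r → d′ ≡ c - t + (k - a) * a → e * a ≡ a →
            (1ℤ - e) * d + (- 1ℤ * w + (e * d′ + 0ℤ)) ≡ 1ℤ * d + (- 1ℤ * w + ((h + c) * e + (- 1ℤ * (e * r) + (- 1ℤ * (e * t) + (- 1ℤ * (a * a) + 0ℤ)))))
          subst-rows w e t r a c k h refl refl ea = trans (ring w e t r a c k h)
            (cong (λ u → 1ℤ * (- h + k * a + r) + (- 1ℤ * w + ((h + c) * e + (- 1ℤ * (e * r) + (- 1ℤ * (e * t) + (- 1ℤ * (u * a) + 0ℤ)))))) ea)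
            where
            ring : ∀ w e t r a c k h → (1ℤ - e) * (- h + k * a + r) + (- 1ℤ * w + (e * (c - t + (k - a) * a) + 0ℤ)) ≡
              1ℤ * (- h + k * a + r) + (- 1ℤ * w + ((h + c) * e + (- 1ℤ * (e * r) + (- 1ℤ * (e * t) + (- 1ℤ * (e * a * a) + 0ℤ)))))
            ring = solve-∀
        weighted : ∀ p → χ p * D* one p ≡ comb l′ p
        weighted p = trans (cong (χ p *_) (D-row p)) (trans (ring h k (χ p) (a p) (r p)) (cong (λ u → - h * χ p + (k * u + (1ℤ * (χ p * r p) + 0ℤ))) (χ*a p)))
          where
          ring : ∀ h k e a r → e * (- h + k * a + r) ≡ - h * e + (k * (e * a) + (1ℤ * (e * r) + 0ℤ))
          ring = solve-∀
        combine : ∀ c n Y E X B S k h {d w e f} → d ≡ (+ 2 * k + 1ℤ) * c - h * n - Y → e ≡ B → f ≡ S →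
          0ℤ ≤ 1ℤ * d + (- 1ℤ * w + ((h + c) * E + (- 1ℤ * e + (- 1ℤ * f + (- 1ℤ * X + 0ℤ))))) →
          w ≡ - h * E + (k * c + (1ℤ * e + 0ℤ)) →
          0ℤ ≤ (k + 1ℤ) * c - h * n - Y + (+ 2 * h + c) * E - X - + 2 * B - S
        combine c n Y E X B S k h refl refl refl p refl = by (ring c n Y E X B S k h) p
          where
          ring : ∀ c n Y E X B S k h → 1ℤ * ((+ 2 * k + 1ℤ) * c - h * n - Y) + (- 1ℤ * (- h * E + (k * c + (1ℤ * B + 0ℤ))) + ((h + c) * E + (- 1ℤ * B + (- 1ℤ * S + (- 1ℤ * X + 0ℤ)))))
            ≡ (k + 1ℤ) * c - h * n - Y + (+ 2 * h + c) * E - X - + 2 * B - S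
          ring = solve-∀

      0≤m : ∀ L → 0ℤ ≤ m L
      0≤m L = sum-nonneg _ λ p → bit-nonneg (bit p L) ⊗ bit-nonneg (pos-bit (a p))

      m≤s : ∀ L → 0ℤ ≤ s L - m L
      m≤s L = by (ring (s L) (m L)) (comb-nonneg ((1ℤ , λ p → x p L * a p) ∷ (- 1ℤ , λ p → x p L * χ p) ∷ [])
                (λ p → by (ring′ (x p L) (a p) (χ p)) (bit-nonneg (bit p L) ⊗ go (sign (a p) (0≤a p)))))
        where
        ring : ∀ s m → 1ℤ * s + (- 1ℤ * m + 0ℤ) ≡ s - m
        ring = solve-∀
        ring′ : ∀ x a c → x * (a - c) ≡ 1ℤ * (x * a) + (- 1ℤ * (x * c) + 0ℤ)
        ring′ = solve-∀
        go : ∀ {i j} → Sign i j → 0ℤ ≤ i - j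
        go zero         = 0≤+ 0
        go (positive n) = 0≤+ n

      -- If `b L` is at most 0, the dual row sum makes `s L` at least `h - k * b L`, hence at least
      -- `h - + 2 * b L` as `k` is at least 2. If `b L` is at least 1 and `L` has a deficient point,
      -- then `+ 2 * b L + s L` is at least 3, and `h` is at most 3.
      line : ∀ L → 0ℤ ≤ m L * (+ 2 * b L + s L - h)
      line L with 0≤∨≤-1 (b L - 1ℤ) | 0≤∨≤-1 (m L - 1ℤ)
      ... | inj₂ b≤0 | _        = 0≤m L ⊗ by (ring (b L) (s L) h k) (Dᵀ-row-nonneg L ⊕ 2≤k ⊗ b≤0)
        where
        ring : ∀ b s h k → - h + k * b + s + (k - + 2) * (- 1ℤ - (b - 1ℤ)) ≡ + 2 * b + s - h
        ring = solve-∀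
      ... | inj₁ 1≤b | inj₁ 1≤m = 0≤m L ⊗ by (ring (b L) (s L) h (m L)) (0≤+ 2 ⊗ 1≤b ⊕ m≤s L ⊕ 1≤m ⊕ h≤3)
        where
        ring : ∀ b s h m → + 2 * (b - 1ℤ) + (s - m) + (m - 1ℤ) + (+ 3 - h) ≡ + 2 * b + s - h
        ring = solve-∀
      ... | inj₁ 1≤b | inj₂ m≤0 = ≤-reflexive (sym (trans (cong (_* (+ 2 * b L + s L - h)) m≡0) (*-zeroˡ (+ 2 * b L + s L - h))))
        where
        ring : ∀ m → - 1ℤ - (m - 1ℤ) ≡ 0ℤ - m
        ring = solve-∀
        m≡0 : m L ≡ 0ℤ
        m≡0 = ≤-antisym (0≤i-j⇒j≤i (by (ring (m L)) m≤0)) (0≤m L)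

      sum-line : 0ℤ ≤ + 2 * sum (λ L → b L * m L) + sum (λ L → s L * m L) - h * ((k + 1ℤ) * E - sum a)
      sum-line = by (trans (cong (λ u → + 2 * B + (1ℤ * S + (- h * u + 0ℤ))) sum-m) (ring B S h ((k + 1ℤ) * E) (sum a)))
        (comb-nonneg ((+ 2 , λ L → b L * m L) ∷ (1ℤ , λ L → s L * m L) ∷ (- h , m) ∷ []) (λ L → by (ring′ (b L) (s L) h (m L)) (line L)))
        where
        B = sum (λ L → b L * m L)
        S = sum (λ L → s L * m L)
        ring : ∀ B S h u c → + 2 * B + (1ℤ * S + (- h * (u + (- 1ℤ * c + 0ℤ)) + 0ℤ)) ≡ + 2 * B + S - h * (u - c)
        ring = solve-∀
        ring′ : ∀ b s h m → m * (+ 2 * b + s - h) ≡ + 2 * (b * m) + (1ℤ * (s * m) + (- h * m + 0ℤ))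
        ring′ = solve-∀
        ring″ : ∀ k d e → e * d ≡ (k + 1ℤ) * e + (- 1ℤ * (e * (k + 1ℤ - d)) + 0ℤ)
        ring″ = solve-∀
        sum-m : sum m ≡ (k + 1ℤ) * E + (- 1ℤ * sum a + 0ℤ)
        sum-m = trans (Deficiency.sum-N1 (flip x) k h order χ)
          (sum-lin ((k + 1ℤ , χ) ∷ (- 1ℤ , a) ∷ []) (λ p → trans (ring″ k (deg p) (χ p)) (cong (λ u → (k + 1ℤ) * χ p + (- 1ℤ * u + 0ℤ)) (χ*a p))))

      -- In `noncollinear-pairs` plus `sum-line` the coefficient of `E` is `h + sum a - h * k`;
      -- adding `E` times the upper bound on `sum a` leaves `- ε`. The sum of `a p * a p + ε * χ p`
      -- is then at least `(1ℤ + ε) * sum a`, since for `a p = 1ℤ + i` the difference is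
      -- `i * i + (1ℤ - ε) * i`.
      deficiency-bound : ∀ ε → 0ℤ ≤ 1ℤ - ε → 0ℤ ≤ h * k - h - ε - sum a → 0ℤ ≤ (k + h - 1ℤ - ε) * sum a - h * + n
      deficiency-bound ε ε≤1 c≤ = by (ring k h (+ n) (sum a) ε E X Y (sum (λ L → b L * m L)) (sum (λ L → s L * m L)) (sum (λ L → neg (b L))))
        (noncollinear-pairs ⊕ sum-line ⊕ sum-sq ⊕ 0≤+ 2 ⊗ sum-nonneg _ (λ L → 0≤neg (b L)) ⊕ c≤ ⊗ sum-nonneg _ (λ p → bit-nonneg (pos-bit (a p)))
         ⊕ comb-nonneg ((1ℤ , λ p → a p * a p) ∷ (ε , χ) ∷ (- (1ℤ + ε) , a) ∷ []) (λ p → go (sign (a p) (0≤a p))))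
        where
        ring : ∀ k h n c ε E X Y B S β → (k + 1ℤ) * c - h * n - Y + (+ 2 * h + c) * E - X - + 2 * B - S + (+ 2 * B + S - h * ((k + 1ℤ) * E - c)) + (Y - c - + 2 * β) + + 2 * β
          + (h * k - h - ε - c) * E + (1ℤ * X + (ε * E + (- (1ℤ + ε) * c + 0ℤ))) ≡ (k + h - 1ℤ - ε) * c - h * n
        ring = solve-∀
        go : ∀ {i j} → Sign i j → 0ℤ ≤ 1ℤ * (i * i) + (ε * j + (- (1ℤ + ε) * i + 0ℤ))
        go zero         = ≤-reflexive (ring₀ ε)
          where
          ring₀ : ∀ ε → 0ℤ ≡ 1ℤ * (0ℤ * 0ℤ) + (ε * 0ℤ + (- (1ℤ + ε) * 0ℤ + 0ℤ))
          ring₀ = solve-∀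
        go (positive n) = by (ring₁ (+ n) ε) (0≤+ n ⊗ 0≤+ n ⊕ ε≤1 ⊗ 0≤+ n)
          where
          ring₁ : ∀ n ε → n * n + (1ℤ - ε) * n ≡ 1ℤ * ((1ℤ + n) * (1ℤ + n)) + (ε * 1ℤ + (- (1ℤ + ε) * (1ℤ + n) + 0ℤ))
          ring₁ = solve-∀

    -- Deficiencies at least -1

    module MixedDeficiency (-1≤a : ∀ p → 0ℤ ≤ a p + 1ℤ) (-1≤b : ∀ L → 0ℤ ≤ b L + 1ℤ) (0≤h : 0ℤ ≤ h) where
      -- Points of positive, zero and -1 deficiency are marked by `χ`, `ζ` and `ν`; `y` marks the
      -- lines of size `k + + 2`, and `ρ p` counts those through `p`. In `Z` the long lines through
      -- `p` are paid for by `ρ p`, those missing `p` by `D* one p`.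
      χ ν ζ y ρ : Fin n → ℤ
      χ p = pos (a p)
      ν p = neg (a p)
      ζ p = 1ℤ - χ p - ν p
      y L = neg (b L)
      ρ = N y

      α β Y Z : ℤ
      α = sum ν
      β = sum y
      Y = sum (λ L → b L * b L)
      Z = sum (λ p → ζ p * (D* one p + ρ p))

      0≤ρ : ∀ p → 0ℤ ≤ ρ p
      0≤ρ p = sum-nonneg _ λ L → bit-nonneg (bit p L) ⊗ 0≤neg (b L)

      0≤r+ρ : ∀ p → 0ℤ ≤ r p + ρ p
      0≤r+ρ p = by (ring (r p) (ρ p)) (comb-nonneg ((1ℤ , λ L → x p L * b L) ∷ (1ℤ , λ L → x p L * y L) ∷ [])
                  (λ L → by (ring′ (x p L) (b L) (y L)) (bit-nonneg (bit p L) ⊗ 0≤i+neg (b L))))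
        where
        ring : ∀ r ρ → 1ℤ * r + (1ℤ * ρ + 0ℤ) ≡ r + ρ
        ring = solve-∀
        ring′ : ∀ x b y → x * (b + y) ≡ 1ℤ * (x * b) + (1ℤ * (x * y) + 0ℤ)
        ring′ = solve-∀

      y*b : ∀ L → y L * b L ≡ - y L
      y*b L = go (sign₋₁ (b L) (-1≤b L))
        where
        go : ∀ {i j l} → Sign₋₁ i j l → l * i ≡ - l
        go minus-one    = refl
        go zero         = refl
        go (positive n) = refl

      sum-ρ : sum ρ ≡ (k + + 2) * β
      sum-ρ = trans (sum-N1 y) (trans (sum-lin ((k + + 2 , y) ∷ []) point) (+-identityʳ ((k + + 2) * β)))
        where
        ring : ∀ y k z → y * z ≡ (k + 1ℤ) * y - y * (k + 1ℤ - z)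
        ring = solve-∀
        ring′ : ∀ y k → (k + 1ℤ) * y - - y ≡ (k + + 2) * y + 0ℤ
        ring′ = solve-∀
        point : ∀ L → y L * size L ≡ (k + + 2) * y L + 0ℤ
        point L = trans (ring (y L) k (size L)) (trans (cong (λ u → (k + 1ℤ) * y L - u) (y*b L)) (ring′ (y L) k))

      -- Pointwise, `- h + h * a p + (h - k) * ν p + r p + ρ
      -- p` dominates the summand of `Z`. It equals that summand if `a p` is 0, equals `D* one p + ρ
      -- p` if `a p` is -1, and equals `h * (a p - 1ℤ) + r p + ρ p` if `a
      -- p` is positive. `sum-sq` disposes of `Y` in the total.
      Z-upper : 0ℤ ≤ (k + h) * sum a - h * + n + (h - k) * α + k * β - Z
      Z-upper = combine (sum a) (+ n) α β Y k h Z (sum-one n) sum-r sum-ρ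
        (comb-nonneg ((- h , one) ∷ (h , a) ∷ (h - k , ν) ∷ (1ℤ , r) ∷ (1ℤ , ρ) ∷ (- 1ℤ , λ p → ζ p * (D* one p + ρ p)) ∷ [])
          (λ p → by (cong (λ u → - h * 1ℤ + (h * a p + ((h - k) * ν p + (1ℤ * r p + (1ℤ * ρ p + (- 1ℤ * (ζ p * (u + ρ p)) + 0ℤ)))))) (sym (D-row p)))
                    (go (sign₋₁ (a p) (-1≤a p)) (D-row-nonneg p) (0≤ρ p) (0≤r+ρ p))))
        sum-sq
        where
        combine : ∀ c n α β Y k h Z {o r ρ} → o ≡ n → r ≡ (k + 1ℤ) * c - Y → ρ ≡ (k + + 2) * β →
          0ℤ ≤ - h * o + (h * c + ((h - k) * α + (1ℤ * r + (1ℤ * ρ + (- 1ℤ * Z + 0ℤ))))) → 0ℤ ≤ Y - c - + 2 * β →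
          0ℤ ≤ (k + h) * c - h * n + (h - k) * α + k * β - Z
        combine c n α β Y k h Z refl refl refl p q = by (ring c n α β Y k h Z) (p ⊕ q)
          where
          ring : ∀ c n α β Y k h Z → - h * n + (h * c + ((h - k) * α + (1ℤ * ((k + 1ℤ) * c - Y) + (1ℤ * ((k + + 2) * β) + (- 1ℤ * Z + 0ℤ))))) + (Y - c - + 2 * β)
            ≡ (k + h) * c - h * n + (h - k) * α + k * β - Z
          ring = solve-∀
        go : ∀ {i j l r ρ} → Sign₋₁ i j l → 0ℤ ≤ - h + k * i + r → 0ℤ ≤ ρ → 0ℤ ≤ r + ρ →
          0ℤ ≤ - h * 1ℤ + (h * i + ((h - k) * l + (1ℤ * r + (1ℤ * ρ + (- 1ℤ * ((1ℤ - j - l) * (- h + k * i + r + ρ)) + 0ℤ)))))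
        go {r = r} {ρ} minus-one row 0≤ρ _ = by (ring h k r ρ) (row ⊕ 0≤ρ)
          where
          ring : ∀ h k r ρ → - h + k * - 1ℤ + r + ρ ≡
            - h * 1ℤ + (h * - 1ℤ + ((h - k) * 1ℤ + (1ℤ * r + (1ℤ * ρ + (- 1ℤ * ((1ℤ - 0ℤ - 1ℤ) * (- h + k * - 1ℤ + r + ρ)) + 0ℤ)))))
          ring = solve-∀
        go {r = r} {ρ} zero _ _ _ = ≤-reflexive (ring h k r ρ)
          where
          ring : ∀ h k r ρ → 0ℤ ≡
            - h * 1ℤ + (h * 0ℤ + ((h - k) * 0ℤ + (1ℤ * r + (1ℤ * ρ + (- 1ℤ * ((1ℤ - 0ℤ - 0ℤ) * (- h + k * 0ℤ + r + ρ)) + 0ℤ)))))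
          ring = solve-∀
        go {r = r} {ρ} (positive n) _ _ 0≤r+ρ = by (ring h k r ρ (+ n)) (0≤h ⊗ 0≤+ n ⊕ 0≤r+ρ)
          where
          ring : ∀ h k r ρ n → h * n + (r + ρ) ≡
            - h * 1ℤ + (h * (1ℤ + n) + ((h - k) * 0ℤ + (1ℤ * r + (1ℤ * ρ + (- 1ℤ * ((1ℤ - 1ℤ - 0ℤ) * (- h + k * (1ℤ + n) + r + ρ)) + 0ℤ)))))
          ring = solve-∀

      -- `D*-N` at `g = y`: a long line has size `k + + 2`, so `size L - deg p` is `a p + 1ℤ`.
      D*ρ : ∀ p → D* ρ p ≡ N (Dᵀ* y) p + (a p + 1ℤ) * (β - ρ p)
      D*ρ p = trans (D*-N x y p) (cong (λ u → N (Dᵀ* y) p + u)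
        (trans (sum-lin ((a p + 1ℤ , y) ∷ (- (a p + 1ℤ) , λ L → x p L * y L) ∷ []) point) (ring (a p) β (ρ p))))
        where
        ring : ∀ a β ρ → (a + 1ℤ) * β + (- (a + 1ℤ) * ρ + 0ℤ) ≡ (a + 1ℤ) * (β - ρ)
        ring = solve-∀
        ring₁ : ∀ x y z d k → (1ℤ - x) * y * (z - d) ≡ (1ℤ - x) * (y * (k + 1ℤ - d) - y * (k + 1ℤ - z))
        ring₁ = solve-∀
        ring₂ : ∀ x y a → (1ℤ - x) * (y * a - - y) ≡ (a + 1ℤ) * y + (- (a + 1ℤ) * (x * y) + 0ℤ)
        ring₂ = solve-∀
        point : ∀ L → (1ℤ - x p L) * y L * (size L - deg p) ≡ (a p + 1ℤ) * y L + (- (a p + 1ℤ) * (x p L * y L) + 0ℤ)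
        point L = trans (ring₁ (x p L) (y L) (size L) (deg p) k) (trans (cong (λ u → (1ℤ - x p L) * (y L * a p - u)) (y*b L)) (ring₂ (x p L) (y L) (a p)))

      -- Limits how many long lines one non-collinear point can account for: no more than its
      -- degree, which `-1≤a` bounds.
      ρ≤k+2 : ∀ p → 0ℤ ≤ k + + 2 - ρ p
      ρ≤k+2 p = by (ring k (deg p) (ρ p)) (-1≤a p ⊕ comb-nonneg ((1ℤ , λ L → x p L * 1ℤ) ∷ (- 1ℤ , λ L → x p L * y L) ∷ [])
                  (λ L → by (ring′ (x p L) (y L)) (bit-nonneg (bit p L) ⊗ go (sign₋₁ (b L) (-1≤b L)))))
        where
        ring : ∀ k d ρ → k + 1ℤ - d + 1ℤ + (1ℤ * d + (- 1ℤ * ρ + 0ℤ)) ≡ k + + 2 - ρ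
        ring = solve-∀
        ring′ : ∀ x y → x * (1ℤ - y) ≡ 1ℤ * (x * 1ℤ) + (- 1ℤ * (x * y) + 0ℤ)
        ring′ = solve-∀
        go : ∀ {i j l} → Sign₋₁ i j l → 0ℤ ≤ 1ℤ - l
        go minus-one    = 0≤+ 0
        go zero         = 0≤+ 1
        go (positive n) = 0≤+ 1

      -- Every long line missing a point of deficiency 0 has a point not collinear with it.
      D-lower : ∀ p → 0ℤ ≤ (k + + 2) * D* one p - (a p + 1ℤ) * (β - ρ p)
      D-lower p = by (trans (cong (λ u → (k + + 2) * D* one p + (- 1ℤ * u + 0ℤ) + N (Dᵀ* y) p) (D*ρ p)) (ring ((k + + 2) * D* one p) (N (Dᵀ* y) p) ((a p + 1ℤ) * (β - ρ p))))
        (comb-nonneg ((k + + 2 , λ q → D p q * 1ℤ) ∷ (- 1ℤ , λ q → D p q * ρ q) ∷ []) (λ q → by (ring′ (D p q) k (ρ q)) (D-nonneg p q ⊗ ρ≤k+2 q))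
         ⊕ sum-nonneg _ (λ L → bit-nonneg (bit p L) ⊗ Dᵀ*-nonneg (λ M → 0≤neg (b M)) L))
        where
        ring : ∀ u v w → u + (- 1ℤ * (v + w) + 0ℤ) + v ≡ u - w
        ring = solve-∀
        ring′ : ∀ d k ρ → d * (k + + 2 - ρ) ≡ (k + + 2) * (d * 1ℤ) + (- 1ℤ * (d * ρ) + 0ℤ)
        ring′ = solve-∀

      0≤k+2 : 0ℤ ≤ k + + 2
      0≤k+2 = by (ring k) (2≤k ⊕ 0≤+ 4)
        where
        ring : ∀ k → k - + 2 + + 4 ≡ k + + 2
        ring = solve-∀

      -- At deficiency 0, `D-lower` covers the `β - ρ p` long lines that miss `p`, and the added
      -- `ρ p` covers the others.
      scaled : ∀ p → 0ℤ ≤ ζ p * ((k + + 2) * (D* one p + ρ p) - β)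
      scaled p = go (sign₋₁ (a p) (-1≤a p)) (D-lower p) (0≤ρ p)
        where
        go : ∀ {i j l d ρ} → Sign₋₁ i j l → 0ℤ ≤ (k + + 2) * d - (i + 1ℤ) * (β - ρ) → 0ℤ ≤ ρ → 0ℤ ≤ (1ℤ - j - l) * ((k + + 2) * (d + ρ) - β)
        go {d = d} {ρ} minus-one _ _ = ≤-reflexive (sym (*-zeroˡ ((k + + 2) * (d + ρ) - β)))
        go {d = d} {ρ} zero p q = by (ring k d ρ β) (p ⊕ (2≤k ⊕ 0≤+ 3) ⊗ q)
          where
          ring : ∀ k d ρ β → (k + + 2) * d - (0ℤ + 1ℤ) * (β - ρ) + (k - + 2 + + 3) * ρ ≡ (1ℤ - 0ℤ - 0ℤ) * ((k + + 2) * (d + ρ) - β)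
          ring = solve-∀
        go {d = d} {ρ} (positive n) _ _ = ≤-reflexive (sym (*-zeroˡ ((k + + 2) * (d + ρ) - β)))

      ζ-bit : ∀ p → Bit (ζ p)
      ζ-bit p = go (sign₋₁ (a p) (-1≤a p))
        where
        go : ∀ {i j l} → Sign₋₁ i j l → Bit (1ℤ - j - l)
        go minus-one    = inj₁ refl
        go zero         = inj₂ refl
        go (positive n) = inj₁ refl

      -- Integrality removes the factor `k + + 2`: once there is a long line, `scaled` forces
      -- `D* one p + ρ p` to be positive at deficiency 0.
      unscaled : 0ℤ ≤ β - 1ℤ → ∀ p → 0ℤ ≤ ζ p * (D* one p + ρ p - 1ℤ)
      unscaled 1≤β p = go (ζ-bit p) (scaled p)
        where
        go : ∀ {i d} → Bit i → 0ℤ ≤ i * ((k + + 2) * d - β) → 0ℤ ≤ i * (d - 1ℤ)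
        go {d = d} (inj₁ refl) _ = ≤-reflexive (sym (*-zeroˡ (d - 1ℤ)))
        go {d = d} (inj₂ refl) q with 0≤∨≤-1 (d - 1ℤ)
        ... | inj₁ 1≤d = by (sym (*-identityˡ (d - 1ℤ))) 1≤d
        ... | inj₂ d≤0 = ⊥-elim (¬0≤-1 (by (ring k d β) (q ⊕ 0≤k+2 ⊗ d≤0 ⊕ 1≤β)))
          where
          ring : ∀ k d β → 1ℤ * ((k + + 2) * d - β) + (k + + 2) * (- 1ℤ - (d - 1ℤ)) + (β - 1ℤ) ≡ - 1ℤ
          ring = solve-∀

      -- `sum a + + 2 * α` is the sum of the absolute values of the deficiencies, hence at least the
      -- number of points of nonzero deficiency.
      ζ-lower : 0ℤ ≤ sum ζ - (+ n - sum a - + 2 * α)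
      ζ-lower = by (trans (cong (λ u → 1ℤ * sum ζ + (- 1ℤ * u + (1ℤ * sum a + (+ 2 * α + 0ℤ)))) (sum-one n)) (ring (sum ζ) (+ n) (sum a) α))
        (comb-nonneg ((1ℤ , ζ) ∷ (- 1ℤ , one) ∷ (1ℤ , a) ∷ (+ 2 , ν) ∷ []) (λ p → go (sign₋₁ (a p) (-1≤a p))))
        where
        ring : ∀ z n c α → 1ℤ * z + (- 1ℤ * n + (1ℤ * c + (+ 2 * α + 0ℤ))) ≡ z - (n - c - + 2 * α)
        ring = solve-∀
        go : ∀ {i j l} → Sign₋₁ i j l → 0ℤ ≤ 1ℤ * (1ℤ - j - l) + (- 1ℤ * 1ℤ + (1ℤ * i + (+ 2 * l + 0ℤ)))
        go minus-one    = 0≤+ 0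
        go zero         = 0≤+ 0
        go (positive n) = by (ring′ (+ n)) (0≤+ n)
          where
          ring′ : ∀ n → n ≡ 1ℤ * (1ℤ - 1ℤ - 0ℤ) + (- 1ℤ * 1ℤ + (1ℤ * (1ℤ + n) + (+ 2 * 0ℤ + 0ℤ)))
          ring′ = solve-∀

      -- By `unscaled`, `Z` is at least the number of points of deficiency 0. Added to its dual,
      -- this bounds `α + β` from below.
      many-long-lines : 0ℤ ≤ β - 1ℤ → 0ℤ ≤ (k + h) * sum a - h * + n + (h - k) * α + k * β - (+ n - sum a - + 2 * α)
      many-long-lines 1≤β = by (ring ((k + h) * sum a - h * + n + (h - k) * α + k * β) Z (sum ζ) (+ n - sum a - + 2 * α))
        (Z-upper ⊕ comb-nonneg ((1ℤ , λ p → ζ p * (D* one p + ρ p)) ∷ (- 1ℤ , ζ) ∷ []) (λ p → by (ring′ (ζ p) (D* one p + ρ p)) (unscaled 1≤β p)) ⊕ ζ-lower)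
        where
        ring : ∀ u Z z w → u - Z + (1ℤ * Z + (- 1ℤ * z + 0ℤ)) + (z - w) ≡ u - w
        ring = solve-∀
        ring′ : ∀ z d → z * (d - 1ℤ) ≡ 1ℤ * (z * d) + (- 1ℤ * z + 0ℤ)
        ring′ = solve-∀

      -- The same comparison through `scaled`, where each point of deficiency 0 counts `β` times;
      -- this serves to bound `α + β` from above.
      few-long-lines : 0ℤ ≤ (k + + 2) * ((k + h) * sum a - h * + n + (h - k) * α + k * β) - β * (+ n - sum a - + 2 * α)
      few-long-lines = by (ring k β ((k + h) * sum a - h * + n + (h - k) * α + k * β) Z (sum ζ) (+ n - sum a - + 2 * α))
        (0≤k+2 ⊗ Z-upper ⊕ comb-nonneg ((k + + 2 , λ p → ζ p * (D* one p + ρ p)) ∷ (- β , ζ) ∷ []) (λ p → by (ring′ (ζ p) (D* one p + ρ p) k β) (scaled p))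
         ⊕ sum-nonneg _ (λ L → 0≤neg (b L)) ⊗ ζ-lower)
        where
        ring : ∀ k β u Z z w → (k + + 2) * (u - Z) + ((k + + 2) * Z + (- β * z + 0ℤ)) + β * (z - w) ≡ (k + + 2) * u - β * w
        ring = solve-∀
        ring′ : ∀ z d k β → z * ((k + + 2) * d - β) ≡ (k + + 2) * (z * d) + (- β * z + 0ℤ)
        ring′ = solve-∀

  -- Polynomial inequalities in k

  absurd : ∀ {i} → i ≡ - 1ℤ → 0ℤ ≤ i → ⊥
  absurd eq 0≤i = ¬0≤-1 (by eq 0≤i)

  module LongLineArithmetic (k b c β n : ℤ) (2≤k : 0ℤ ≤ k - + 2) (neg-b≤β : 0ℤ ≤ β - - b) where

    0≤k : 0ℤ ≤ k
    0≤k = by (ring k) (2≤k ⊕ 0≤+ 2)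
      where
      ring : ∀ k → k - + 2 + + 2 ≡ k
      ring = solve-∀

    0≤2k-2 : 0ℤ ≤ + 2 * (k - + 2) + + 2
    0≤2k-2 = 0≤+ 2 ⊗ 2≤k ⊕ 0≤+ 2

    0≤2k+1 : 0ℤ ≤ + 2 * k + 1ℤ
    0≤2k+1 = 0≤+ 2 ⊗ 0≤k ⊕ 0≤+ 1

    LongLineBound : ℤ → Set
    LongLineBound h = 0ℤ ≤ (+ 2 * k - + 2) * c - h * n + + 2 * h - + 2 * k * b + + 2 * b * (n - (k + 1ℤ - b)) - + 2 * β - (b * b + b)

    SquareBound : ℤ → Set
    SquareBound h = 0ℤ ≤ (+ 2 * k + 1ℤ) * c - h * n - b * b

    -- `T` is the square bound at the largest admissible `c`, so `b * b` stays below `+ 4 * k * k`.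
    -- The long-line bound is convex in `b`; this range allows replacing `b * b` by
    -- `- (+ 2 * k - 1ℤ) * b`.
    -b<2k : ∀ h ε T → n ≡ k * k + k + 1ℤ - h → T ≡ (+ 2 * k + 1ℤ) * (h * k - h - ε) - h * n →
            0ℤ ≤ + 4 * k * k - T - 1ℤ → 0ℤ ≤ h * k - h - ε - c → SquareBound h → 0ℤ ≤ + 2 * k - 1ℤ + b
    -b<2k h ε T refl refl T<4k² slack square with 0≤∨≤-1 (+ 2 * k - 1ℤ + b)
    ... | inj₁ 0≤q = 0≤q
    ... | inj₂ q<0 = ⊥-elim (absurd (ring k b c h ε) (T<4k² ⊕ square ⊕ 0≤2k+1 ⊗ slack ⊕ q<0 ⊗ (q<0 ⊕ 0≤+ 4 ⊗ 0≤k)))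
      where
      ring : ∀ k b c h ε → + 4 * k * k - ((+ 2 * k + 1ℤ) * (h * k - h - ε) - h * (k * k + k + 1ℤ - h)) - 1ℤ
        + ((+ 2 * k + 1ℤ) * c - h * (k * k + k + 1ℤ - h) - b * b) + (+ 2 * k + 1ℤ) * (h * k - h - ε - c)
        + (- 1ℤ - (+ 2 * k - 1ℤ + b)) * (- 1ℤ - (+ 2 * k - 1ℤ + b) + + 4 * k) ≡ - 1ℤ
      ring = solve-∀

    -- With `c` replaced by its upper bound, `β` by `- b`, and `b * b` by the linear function that
    -- `0≤q` permits, the long-line bound becomes linear in `b` and is negative for all `b` up to
    -- -1.
    no-long-line₁ : n ≡ k * k + k + 1ℤ - + 1 → 0ℤ ≤ + 1 * k - + 1 - 0ℤ - c → 0ℤ ≤ - 1ℤ - b → SquareBound (+ 1) → LongLineBound (+ 1) → ⊥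
    no-long-line₁ refl slack b<0 square long =
      absurd (ring k b c β) (long ⊕ 0≤2k-2 ⊗ slack ⊕ 0≤+ 2 ⊗ neg-b≤β ⊕ b<0 ⊗ (0≤+ 2 ⊗ 0≤k ⊗ 2≤k) ⊕ (0≤+ 1 ⊕ b<0) ⊗ 0≤q ⊕ (2≤k ⊗ 2≤k ⊕ 0≤+ 5 ⊗ 2≤k ⊕ 0≤+ 1))
      where
      T : ℤ
      T = (+ 2 * k + 1ℤ) * (+ 1 * k - + 1 - 0ℤ) - + 1 * (k * k + k + 1ℤ - + 1)
      T<4k² : 0ℤ ≤ + 4 * k * k - T - 1ℤ
      T<4k² = by (ring′ k) (0≤+ 3 ⊗ 0≤k ⊗ 0≤k ⊕ 0≤+ 2 ⊗ 0≤k)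
        where
        ring′ : ∀ k → + 3 * k * k + + 2 * k ≡ + 4 * k * k - ((+ 2 * k + 1ℤ) * (+ 1 * k - + 1 - 0ℤ) - + 1 * (k * k + k + 1ℤ - + 1)) - 1ℤ
        ring′ = solve-∀
      0≤q : 0ℤ ≤ + 2 * k - 1ℤ + b
      0≤q = -b<2k (+ 1) 0ℤ T refl refl T<4k² slack square
      ring : ∀ k b c β → (+ 2 * k - + 2) * c - + 1 * (k * k + k + 1ℤ - + 1) + + 2 * + 1 - + 2 * k * b + + 2 * b * (k * k + k + 1ℤ - + 1 - (k + 1ℤ - b)) - + 2 * β - (b * b + b)
        + (+ 2 * (k - + 2) + + 2) * (+ 1 * k - + 1 - 0ℤ - c) + + 2 * (β - - b) + (- 1ℤ - b) * (+ 2 * k * (k - + 2)) + (1ℤ + (- 1ℤ - b)) * (+ 2 * k - 1ℤ + b)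
        + ((k - + 2) * (k - + 2) + + 5 * (k - + 2) + 1ℤ) ≡ - 1ℤ
      ring = solve-∀

    no-long-line₂ : n ≡ k * k + k + 1ℤ - + 2 → 0ℤ ≤ + 2 * k - + 2 - 0ℤ - c → 0ℤ ≤ - 1ℤ - b → SquareBound (+ 2) → LongLineBound (+ 2) → ⊥
    no-long-line₂ refl slack b<0 square long with 0≤∨≤-1 (k - + 2 - 1ℤ)
    -- For `k = 2` the order is 5 and `c` is at most 2, so the square bound makes `b * b` at most 0.
    ... | inj₂ k≤2 = absurd (ring k b c) (square ⊕ 0≤2k+1 ⊗ slack ⊕ 0≤+ 2 ⊗ 0≤k ⊗ k≤2 ⊕ b<0 ⊗ (b<0 ⊕ 0≤+ 2))
      where
      ring : ∀ k b c → (+ 2 * k + 1ℤ) * c - + 2 * (k * k + k + 1ℤ - + 2) - b * b + (+ 2 * k + 1ℤ) * (+ 2 * k - + 2 - 0ℤ - c)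
        + + 2 * k * (- 1ℤ - (k - + 2 - 1ℤ)) + (- 1ℤ - b) * (- 1ℤ - b + + 2) ≡ - 1ℤ
      ring = solve-∀
    ... | inj₁ 3≤k =
      absurd (ring k b c β) (long ⊕ 0≤2k-2 ⊗ slack ⊕ 0≤+ 2 ⊗ neg-b≤β ⊕ b<0 ⊗ (0≤+ 2 ⊗ 3≤k ⊗ 3≤k ⊕ 0≤+ 8 ⊗ 3≤k ⊕ 0≤+ 4) ⊕ (0≤+ 1 ⊕ b<0) ⊗ 0≤q ⊕ (0≤+ 6 ⊗ 3≤k ⊕ 0≤+ 5))
      where
      T : ℤ
      T = (+ 2 * k + 1ℤ) * (+ 2 * k - + 2 - 0ℤ) - + 2 * (k * k + k + 1ℤ - + 2)
      T<4k² : 0ℤ ≤ + 4 * k * k - T - 1ℤ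
      T<4k² = by (ring′ k) (0≤+ 2 ⊗ 0≤k ⊗ 0≤k ⊕ 0≤+ 4 ⊗ 2≤k ⊕ 0≤+ 7)
        where
        ring′ : ∀ k → + 2 * k * k + + 4 * (k - + 2) + + 7 ≡ + 4 * k * k - ((+ 2 * k + 1ℤ) * (+ 2 * k - + 2 - 0ℤ) - + 2 * (k * k + k + 1ℤ - + 2)) - 1ℤ
        ring′ = solve-∀
      0≤q : 0ℤ ≤ + 2 * k - 1ℤ + b
      0≤q = -b<2k (+ 2) 0ℤ T refl refl T<4k² slack square
      ring : ∀ k b c β → (+ 2 * k - + 2) * c - + 2 * (k * k + k + 1ℤ - + 2) + + 2 * + 2 - + 2 * k * b + + 2 * b * (k * k + k + 1ℤ - + 2 - (k + 1ℤ - b)) - + 2 * β - (b * b + b)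
        + (+ 2 * (k - + 2) + + 2) * (+ 2 * k - + 2 - 0ℤ - c) + + 2 * (β - - b)
        + (- 1ℤ - b) * (+ 2 * (k - + 2 - 1ℤ) * (k - + 2 - 1ℤ) + + 8 * (k - + 2 - 1ℤ) + + 4) + (1ℤ + (- 1ℤ - b)) * (+ 2 * k - 1ℤ + b)
        + (+ 6 * (k - + 2 - 1ℤ) + + 5) ≡ - 1ℤ
      ring = solve-∀

    -- For `k = 2` the order would be 4 and `c` at most 2, so the square bound would make `b * b` at
    -- most -2.
    3≤k-from-square : n ≡ k * k + k + 1ℤ - + 3 → 0ℤ ≤ + 3 * k - + 3 - 1ℤ - c → 0ℤ ≤ - 1ℤ - b → SquareBound (+ 3) → 0ℤ ≤ k - + 2 - 1ℤ
    3≤k-from-square refl slack b<0 square with 0≤∨≤-1 (k - + 2 - 1ℤ)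
    ... | inj₁ 3≤k = 3≤k
    ... | inj₂ k≤2 = ⊥-elim (absurd (ring k b c) (square ⊕ 0≤2k+1 ⊗ slack ⊕ (0≤+ 3 ⊗ 2≤k ⊕ 0≤+ 4) ⊗ k≤2 ⊕ b<0 ⊗ (b<0 ⊕ 0≤+ 2) ⊕ 0≤+ 2))
      where
      ring : ∀ k b c → (+ 2 * k + 1ℤ) * c - + 3 * (k * k + k + 1ℤ - + 3) - b * b + (+ 2 * k + 1ℤ) * (+ 3 * k - + 3 - 1ℤ - c)
        + (+ 3 * (k - + 2) + + 4) * (- 1ℤ - (k - + 2 - 1ℤ)) + (- 1ℤ - b) * (- 1ℤ - b + + 2) + + 2 ≡ - 1ℤ
      ring = solve-∀

    no-very-long-line₃ : n ≡ k * k + k + 1ℤ - + 3 → 0ℤ ≤ + 3 * k - + 3 - 1ℤ - c → 0ℤ ≤ - 1ℤ - (b + 1ℤ) → 0ℤ ≤ k - + 2 - 1ℤ →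
                         SquareBound (+ 3) → LongLineBound (+ 3) → ⊥
    no-very-long-line₃ refl slack b<-1 3≤k square long =
      absurd (ring k b c β) (long ⊕ 0≤2k-2 ⊗ slack ⊕ 0≤+ 2 ⊗ neg-b≤β ⊕ b<-1 ⊗ (0≤+ 2 ⊗ 3≤k ⊗ 3≤k ⊕ 0≤+ 8 ⊗ 3≤k ⊕ 0≤+ 2) ⊕ (0≤+ 2 ⊕ b<-1) ⊗ 0≤q
                              ⊕ (3≤k ⊗ 3≤k ⊕ 0≤+ 15 ⊗ 3≤k ⊕ 0≤+ 7))
      where
      T : ℤ
      T = (+ 2 * k + 1ℤ) * (+ 3 * k - + 3 - 1ℤ) - + 3 * (k * k + k + 1ℤ - + 3)
      T<4k² : 0ℤ ≤ + 4 * k * k - T - 1ℤ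
      T<4k² = by (ring′ k) (0≤k ⊗ 0≤k ⊕ 0≤+ 8 ⊗ 2≤k ⊕ 0≤+ 13)
        where
        ring′ : ∀ k → k * k + + 8 * (k - + 2) + + 13 ≡ + 4 * k * k - ((+ 2 * k + 1ℤ) * (+ 3 * k - + 3 - 1ℤ) - + 3 * (k * k + k + 1ℤ - + 3)) - 1ℤ
        ring′ = solve-∀
      0≤q : 0ℤ ≤ + 2 * k - 1ℤ + b
      0≤q = -b<2k (+ 3) 1ℤ T refl refl T<4k² slack square
      ring : ∀ k b c β → (+ 2 * k - + 2) * c - + 3 * (k * k + k + 1ℤ - + 3) + + 2 * + 3 - + 2 * k * b + + 2 * b * (k * k + k + 1ℤ - + 3 - (k + 1ℤ - b)) - + 2 * β - (b * b + b)
        + (+ 2 * (k - + 2) + + 2) * (+ 3 * k - + 3 - 1ℤ - c) + + 2 * (β - - b)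
        + (- 1ℤ - (b + 1ℤ)) * (+ 2 * (k - + 2 - 1ℤ) * (k - + 2 - 1ℤ) + + 8 * (k - + 2 - 1ℤ) + + 2) + (+ 2 + (- 1ℤ - (b + 1ℤ))) * (+ 2 * k - 1ℤ + b)
        + ((k - + 2 - 1ℤ) * (k - + 2 - 1ℤ) + + 15 * (k - + 2 - 1ℤ) + + 7) ≡ - 1ℤ
      ring = solve-∀

    -- For `b = - 1ℤ` the long-line bound is consistent when `k` is large; with `c` at its maximum
    -- it becomes a bound on `β`.
    β-upper₃ : n ≡ k * k + k + 1ℤ - + 3 → 0ℤ ≤ + 3 * k - + 3 - 1ℤ - c → b ≡ - 1ℤ → LongLineBound (+ 3) → 0ℤ ≤ k * k - + 15 * k + + 28 - + 2 * β
    β-upper₃ refl slack refl long = by (ring k c β) (long ⊕ 0≤2k-2 ⊗ slack)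
      where
      ring : ∀ k c β → (+ 2 * k - + 2) * c - + 3 * (k * k + k + 1ℤ - + 3) + + 2 * + 3 - + 2 * k * - 1ℤ + + 2 * - 1ℤ * (k * k + k + 1ℤ - + 3 - (k + 1ℤ - - 1ℤ)) - + 2 * β - (- 1ℤ * - 1ℤ + - 1ℤ)
        + (+ 2 * (k - + 2) + + 2) * (+ 3 * k - + 3 - 1ℤ - c) ≡ k * k - + 15 * k + + 28 - + 2 * β
      ring = solve-∀

  mixed-contradiction : ∀ k α β c n → n ≡ k * k + k + 1ℤ - + 3 → 0ℤ ≤ k - + 2 - 1ℤ → 0ℤ ≤ + 3 * k - + 3 - 1ℤ - c →
    0ℤ ≤ α - 1ℤ → 0ℤ ≤ β - 1ℤ → 0ℤ ≤ k * k - + 15 * k + + 28 - + 2 * α → 0ℤ ≤ k * k - + 15 * k + + 28 - + 2 * β →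
    0ℤ ≤ (k + + 3) * c - + 3 * n + (+ 3 - k) * α + k * β - (n - c - + 2 * α) →
    0ℤ ≤ (k + + 3) * c - + 3 * n + (+ 3 - k) * β + k * α - (n - c - + 2 * β) →
    0ℤ ≤ (k + + 2) * ((k + + 3) * c - + 3 * n + (+ 3 - k) * α + k * β) - β * (n - c - + 2 * α) →
    0ℤ ≤ (k + + 2) * ((k + + 3) * c - + 3 * n + (+ 3 - k) * β + k * α) - α * (n - c - + 2 * β) → ⊥
  mixed-contradiction k α β c n refl 3≤k slack 1≤α 1≤β α≤ β≤ many-β many-α few-β few-α with 0≤∨≤-1 (k - + 13)
  -- As `β` is at least 1, `β≤` gives `0ℤ ≤ (k - + 2) * (k - + 13)`.
  ... | inj₂ k≤12 = absurd (ring k β) (β≤ ⊕ 0≤+ 2 ⊗ 1≤β ⊕ (3≤k ⊕ 0≤+ 1) ⊗ k≤12 ⊕ 3≤k)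
    where
    ring : ∀ k β → k * k - + 15 * k + + 28 - + 2 * β + + 2 * (β - 1ℤ) + (k - + 2 - 1ℤ + 1ℤ) * (- 1ℤ - (k - + 13)) + (k - + 2 - 1ℤ) ≡ - 1ℤ
    ring = solve-∀
  -- `many` times `+ 10 * k - + 32` plus five times `few` eliminates `α + β`; the rest is a cubic in
  -- `k - + 13` with all coefficients of one sign.
  ... | inj₁ 13≤k = absurd (ring k (α + β))
      ((0≤+ 10 ⊗ 13≤k ⊕ 0≤+ 98) ⊗ many ⊕ 0≤+ 5 ⊗ few
       ⊕ (0≤+ 20 ⊗ 13≤k ⊗ 13≤k ⊗ 13≤k ⊕ 0≤+ 616 ⊗ 13≤k ⊗ 13≤k ⊕ 0≤+ 6312 ⊗ 13≤k ⊕ 0≤+ 21499))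
    where
    0≤k : 0ℤ ≤ k
    0≤k = by (ring k) (3≤k ⊕ 0≤+ 3)
      where
      ring : ∀ k → k - + 2 - 1ℤ + + 3 ≡ k
      ring = solve-∀
    0≤α : 0ℤ ≤ α
    0≤α = by (ring α) (1≤α ⊕ 0≤+ 1)
      where
      ring : ∀ α → α - 1ℤ + 1ℤ ≡ α
      ring = solve-∀
    0≤β : 0ℤ ≤ β
    0≤β = by (ring β) (1≤β ⊕ 0≤+ 1)
      where
      ring : ∀ β → β - 1ℤ + 1ℤ ≡ β
      ring = solve-∀
    many : 0ℤ ≤ + 5 * (α + β) - + 2 * (k * k - + 4 * k + + 8)
    many = by (ring k α β c) (many-β ⊕ many-α ⊕ (0≤+ 2 ⊗ (0≤k ⊕ 0≤+ 4)) ⊗ slack)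
      where
      ring : ∀ k α β c → (k + + 3) * c - + 3 * (k * k + k + 1ℤ - + 3) + (+ 3 - k) * α + k * β - (k * k + k + 1ℤ - + 3 - c - + 2 * α)
        + ((k + + 3) * c - + 3 * (k * k + k + 1ℤ - + 3) + (+ 3 - k) * β + k * α - (k * k + k + 1ℤ - + 3 - c - + 2 * β))
        + (+ 2 * (k + + 4)) * (+ 3 * k - + 3 - 1ℤ - c) ≡ + 5 * (α + β) - + 2 * (k * k - + 4 * k + + 8)
      ring = solve-∀
    -- Adding `few-β` and `few-α` produces `+ 4 * α * β`. The multiples of `β≤` by `α` and of `α≤`
    -- by `β` cancel it, and also the `k * k` in the coefficient of `α + β`, which becomes linear in
    -- `k`.
    few : 0ℤ ≤ + 4 * (k * k - k - + 6) - (+ 10 * k - + 32) * (α + β)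
    few = by (ring k α β c) (few-β ⊕ few-α ⊕ 0≤α ⊗ β≤ ⊕ 0≤β ⊗ α≤ ⊕ ((0≤+ 2 ⊗ ((0≤k ⊕ 0≤+ 2) ⊗ (0≤k ⊕ 0≤+ 3))) ⊕ 0≤α ⊕ 0≤β) ⊗ slack)
      where
      ring : ∀ k α β c → (k + + 2) * ((k + + 3) * c - + 3 * (k * k + k + 1ℤ - + 3) + (+ 3 - k) * α + k * β) - β * (k * k + k + 1ℤ - + 3 - c - + 2 * α)
        + ((k + + 2) * ((k + + 3) * c - + 3 * (k * k + k + 1ℤ - + 3) + (+ 3 - k) * β + k * α) - α * (k * k + k + 1ℤ - + 3 - c - + 2 * β))
        + α * (k * k - + 15 * k + + 28 - + 2 * β) + β * (k * k - + 15 * k + + 28 - + 2 * α)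
        + (+ 2 * ((k + + 2) * (k + + 3)) + α + β) * (+ 3 * k - + 3 - 1ℤ - c) ≡ + 4 * (k * k - k - + 6) - (+ 10 * k - + 32) * (α + β)
      ring = solve-∀
    ring : ∀ k γ → (+ 10 * (k - + 13) + + 98) * (+ 5 * γ - + 2 * (k * k - + 4 * k + + 8)) + + 5 * (+ 4 * (k * k - k - + 6) - (+ 10 * k - + 32) * γ)
      + (+ 20 * (k - + 13) * (k - + 13) * (k - + 13) + + 616 * (k - + 13) * (k - + 13) + + 6312 * (k - + 13) + + 21499) ≡ - 1ℤ
    ring = solve-∀

  -- The cases h = 1, 2, 3

  module _ {n : ℕ} {x : Fin n → Fin n → ℤ} (lin : Linear x) (k : ℤ) (2≤k : 0ℤ ≤ k - + 2) where

    -- The long-line bound excludes every negative `b L`, so the dual of `deficiency-bound` applies.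
    ¬many-flags₁ : (order : + n ≡ k * k + k + 1ℤ - + 1) → 0ℤ ≤ + 1 * k - + 1 - 0ℤ - sum (Deficiency.a x k (+ 1) order) → ⊥
    ¬many-flags₁ order slack = absurd-count order slackᵀ
        (Plane.NonnegativeDeficiency.deficiency-bound (dual lin) k (+ 1) order 2≤k 0≤b (0≤+ 2) 0ℤ (0≤+ 1) slackᵀ)
      where
      open Deficiency x k (+ 1) order
      open Plane lin k (+ 1) order 2≤k
      slackᵀ : 0ℤ ≤ + 1 * k - + 1 - 0ℤ - sum b
      slackᵀ = by (cong (λ c → + 1 * k - + 1 - 0ℤ - c) (sym sum-b)) slack
      0≤b : ∀ L → 0ℤ ≤ b L
      0≤b L with 0≤∨≤-1 (b L)
      ... | inj₁ 0≤bL = 0≤bL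
      ... | inj₂ b<0  = ⊥-elim (LongLineArithmetic.no-long-line₁ k (b L) (sum a) (sum λ M → neg (b M)) (+ n) 2≤k (-b≤sum-neg L b<0)
                                  order slack b<0 (b²-bound L) (LongLine.long-line-bound L b<0))
      absurd-count : ∀ {n c} → n ≡ k * k + k + 1ℤ - + 1 → 0ℤ ≤ + 1 * k - + 1 - 0ℤ - c → 0ℤ ≤ (k + + 1 - 1ℤ - 0ℤ) * c - + 1 * n → ⊥
      -- Eliminating `c` would give `k * k + k ≤ k * (k - 1ℤ)`.
      absurd-count {c = c} refl slack p = absurd (ring k c) (p ⊕ (2≤k ⊕ 0≤+ 2) ⊗ slack ⊕ (0≤+ 2 ⊗ 2≤k ⊕ 0≤+ 3))
        where
        ring : ∀ k c → (k + + 1 - 1ℤ - 0ℤ) * c - + 1 * (k * k + k + 1ℤ - + 1) + (k - + 2 + + 2) * (+ 1 * k - + 1 - 0ℤ - c) + (+ 2 * (k - + 2) + + 3) ≡ - 1ℤ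
        ring = solve-∀

    ¬many-flags₂ : (order : + n ≡ k * k + k + 1ℤ - + 2) → 0ℤ ≤ + 2 * k - + 2 - 0ℤ - sum (Deficiency.a x k (+ 2) order) → ⊥
    ¬many-flags₂ order slack = absurd-count order slackᵀ
        (Plane.NonnegativeDeficiency.deficiency-bound (dual lin) k (+ 2) order 2≤k 0≤b (0≤+ 1) 0ℤ (0≤+ 1) slackᵀ)
      where
      open Deficiency x k (+ 2) order
      open Plane lin k (+ 2) order 2≤k
      slackᵀ : 0ℤ ≤ + 2 * k - + 2 - 0ℤ - sum b
      slackᵀ = by (cong (λ c → + 2 * k - + 2 - 0ℤ - c) (sym sum-b)) slack
      0≤b : ∀ L → 0ℤ ≤ b L
      0≤b L with 0≤∨≤-1 (b L)
      ... | inj₁ 0≤bL = 0≤bL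
      ... | inj₂ b<0  = ⊥-elim (LongLineArithmetic.no-long-line₂ k (b L) (sum a) (sum λ M → neg (b M)) (+ n) 2≤k (-b≤sum-neg L b<0)
                                  order slack b<0 (b²-bound L) (LongLine.long-line-bound L b<0))
      absurd-count : ∀ {n c} → n ≡ k * k + k + 1ℤ - + 2 → 0ℤ ≤ + 2 * k - + 2 - 0ℤ - c → 0ℤ ≤ (k + + 2 - 1ℤ - 0ℤ) * c - + 2 * n → ⊥
      absurd-count {c = c} refl slack p = absurd (ring k c) (p ⊕ (2≤k ⊕ 0≤+ 3) ⊗ slack ⊕ (0≤+ 2 ⊗ 2≤k ⊕ 0≤+ 3))
        where
        ring : ∀ k c → (k + + 2 - 1ℤ - 0ℤ) * c - + 2 * (k * k + k + 1ℤ - + 2) + (k - + 2 + + 3) * (+ 2 * k - + 2 - 0ℤ - c) + (+ 2 * (k - + 2) + + 3) ≡ - 1ℤ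
        ring = solve-∀

  module Order₃ {n : ℕ} {x : Fin n → Fin n → ℤ} (lin : Linear x) (k : ℤ) (2≤k : 0ℤ ≤ k - + 2) (order : + n ≡ k * k + k + 1ℤ - + 3) where
    open Deficiency x k (+ 3) order
    open Plane lin k (+ 3) order 2≤k

    all-nonnegative : 0ℤ ≤ + 3 * k - + 3 - 1ℤ - sum a → (∀ p → 0ℤ ≤ a p) → ⊥
    all-nonnegative slack 0≤a = absurd-count order slack
        (Plane.NonnegativeDeficiency.deficiency-bound lin k (+ 3) order 2≤k 0≤a (0≤+ 0) 1ℤ (0≤+ 0) slack)
      where
      absurd-count : ∀ {n c} → n ≡ k * k + k + 1ℤ - + 3 → 0ℤ ≤ + 3 * k - + 3 - 1ℤ - c → 0ℤ ≤ (k + + 3 - 1ℤ - 1ℤ) * c - + 3 * n → ⊥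
      absurd-count {c = c} refl slack p = absurd (ring k c) (p ⊕ (2≤k ⊕ 0≤+ 3) ⊗ slack ⊕ (0≤+ 4 ⊗ 2≤k ⊕ 0≤+ 5))
        where
        ring : ∀ k c → (k + + 3 - 1ℤ - 1ℤ) * c - + 3 * (k * k + k + 1ℤ - + 3) + (k - + 2 + + 3) * (+ 3 * k - + 3 - 1ℤ - c) + (+ 4 * (k - + 2) + + 5) ≡ - 1ℤ
        ring = solve-∀

    module _ (slack : 0ℤ ≤ + 3 * k - + 3 - 1ℤ - sum a) where

      β : ℤ
      β = sum λ M → neg (b M)

      module Arithmetic (L : Fin n) (b<0 : 0ℤ ≤ - 1ℤ - b L) =
        LongLineArithmetic k (b L) (sum a) β (+ n) 2≤k (-b≤sum-neg L b<0)

      3≤k : ∀ L → 0ℤ ≤ - 1ℤ - b L → 0ℤ ≤ k - + 2 - 1ℤ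
      3≤k L b<0 = Arithmetic.3≤k-from-square L b<0 order slack b<0 (b²-bound L)

      -1≤b : ∀ L → 0ℤ ≤ b L + 1ℤ
      -1≤b L with 0≤∨≤-1 (b L + 1ℤ)
      ... | inj₁ -1≤bL = -1≤bL
      ... | inj₂ b<-1  = ⊥-elim (Arithmetic.no-very-long-line₃ L b<0 order slack b<-1 (3≤k L b<0) (b²-bound L) (LongLine.long-line-bound L b<0))
        where
        ring : ∀ b → - 1ℤ - (b + 1ℤ) + 1ℤ ≡ - 1ℤ - b
        ring = solve-∀
        b<0 : 0ℤ ≤ - 1ℤ - b L
        b<0 = by (ring (b L)) (b<-1 ⊕ 0≤+ 1)

      β-upper : ∀ L → 0ℤ ≤ - 1ℤ - b L → 0ℤ ≤ k * k - + 15 * k + + 28 - + 2 * β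
      β-upper L b<0 = Arithmetic.β-upper₃ L b<0 order slack b≡-1 (LongLine.long-line-bound L b<0)
        where
        ring : ∀ b → b + 1ℤ ≡ b - - 1ℤ
        ring = solve-∀
        b≡-1 : b L ≡ - 1ℤ
        b≡-1 = ≤-antisym (0≤i-j⇒j≤i b<0) (0≤i-j⇒j≤i (by (ring (b L)) (-1≤b L)))

      1≤β : ∀ L → 0ℤ ≤ - 1ℤ - b L → 0ℤ ≤ β - 1ℤ
      1≤β L b<0 = by (ring β (b L)) (-b≤sum-neg L b<0 ⊕ b<0)
        where
        ring : ∀ β b → β - - b + (- 1ℤ - b) ≡ β - 1ℤ
        ring = solve-∀

  -- If no point or no line has negative deficiency, `all-nonnegative` applies directly or dually.
  -- Otherwise `-1≤b` and its dual supply the hypotheses of `MixedDeficiency` on both sides.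
  ¬many-flags₃ : ∀ {n} {x : Fin n → Fin n → ℤ} → Linear x → ∀ k → 0ℤ ≤ k - + 2 → (order : + n ≡ k * k + k + 1ℤ - + 3) →
               0ℤ ≤ + 3 * k - + 3 - 1ℤ - sum (Deficiency.a x k (+ 3) order) → ⊥
  ¬many-flags₃ {n} {x} lin k 2≤k order slack with any? (λ p → 0ℤ ≤? - 1ℤ - a p) | any? (λ L → 0ℤ ≤? - 1ℤ - b L)
    where open Deficiency x k (+ 3) order
  ... | no all | _ = P.all-nonnegative slack nonneg
    where
    open Deficiency x k (+ 3) order
    module P = Order₃ lin k 2≤k order
    nonneg : ∀ p → 0ℤ ≤ a p
    nonneg p with 0≤∨≤-1 (a p)
    ... | inj₁ 0≤ap = 0≤ap
    ... | inj₂ a<0  = ⊥-elim (all (p , a<0))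
  ... | _ | no all = Q.all-nonnegative (by (cong (λ c → + 3 * k - + 3 - 1ℤ - c) (sym sum-b)) slack) nonneg
    where
    open Deficiency x k (+ 3) order
    module Q = Order₃ (dual lin) k 2≤k order
    nonneg : ∀ L → 0ℤ ≤ b L
    nonneg L with 0≤∨≤-1 (b L)
    ... | inj₁ 0≤bL = 0≤bL
    ... | inj₂ b<0  = ⊥-elim (all (L , b<0))
  ... | yes (p , a<0) | yes (L , b<0) =
      mixed-contradiction k (sum λ q → neg (a q)) (sum λ M → neg (b M)) (sum a) (+ n) order (P.3≤k slack L b<0) slack
        (Q.1≤β slackᵀ p a<0) (P.1≤β slack L b<0) (Q.β-upper slackᵀ p a<0) (P.β-upper slack L b<0)
        (M.many-long-lines (P.1≤β slack L b<0))
        -- The dual statement measures total deficiency by `sum b`; `sum-b` turns it into `sum a`.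
        (subst (λ c → 0ℤ ≤ (k + + 3) * c - + 3 * + n + (+ 3 - k) * β + k * α - (+ n - c - + 2 * β)) sum-b (Mᵀ.many-long-lines (Q.1≤β slackᵀ p a<0)))
        M.few-long-lines
        (subst (λ c → 0ℤ ≤ (k + + 2) * ((k + + 3) * c - + 3 * + n + (+ 3 - k) * β + k * α) - α * (+ n - c - + 2 * β)) sum-b Mᵀ.few-long-lines)
    where
    open Deficiency x k (+ 3) order
    module P = Order₃ lin k 2≤k order
    module Q = Order₃ (dual lin) k 2≤k order
    slackᵀ : 0ℤ ≤ + 3 * k - + 3 - 1ℤ - sum b
    slackᵀ = by (cong (λ c → + 3 * k - + 3 - 1ℤ - c) (sym sum-b)) slack
    module M = Plane.MixedDeficiency lin k (+ 3) order 2≤k (Q.-1≤b slackᵀ) (P.-1≤b slack) (0≤+ 3)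
    module Mᵀ = Plane.MixedDeficiency (dual lin) k (+ 3) order 2≤k (P.-1≤b slack) (Q.-1≤b slackᵀ) (0≤+ 3)
    α β : ℤ
    α = sum λ q → neg (a q)
    β = sum λ M → neg (b M)

  -- Subgraphs as incidence matrices

  indicator : Bool → ℤ
  indicator false = 0ℤ
  indicator true  = 1ℤ

  indicator-bit : ∀ s → Bit (indicator s)
  indicator-bit false = inj₁ refl
  indicator-bit true  = inj₂ refl

  indicator≡1⇒true : ∀ s → indicator s ≡ 1ℤ → s ≡ true
  indicator≡1⇒true true _ = refl

  matrix : ∀ {m n} → Vec (Subset n) m → Fin m → Fin n → ℤ
  matrix G u v = indicator (lookup (lookup G u) v)

  matrix-linear : ∀ {n} (G : Subgraph n) → C₄-Free G → Linear (matrix G)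
  matrix-linear G c4free = record
    { bit  = λ u v → indicator-bit (lookup (lookup G u) v)
    ; free = λ {u} {u′} {v} {v′} u≢u′ v≢v′ uv uv′ u′v u′v′ →
        c4free (u , u′ , v , v′ , u≢u′ , v≢v′ , edge u v uv , edge u v′ uv′ , edge u′ v u′v , edge u′ v′ u′v′)
    }
    where
    edge : ∀ u v → matrix G u v ≡ 1ℤ → Edge G u v
    edge u v uv = lookup⇒[]= v (lookup G u) (indicator≡1⇒true _ uv)

  sum-indicator : ∀ {n} (S : Subset n) → sum (λ v → indicator (lookup S v) * 1ℤ) ≡ + ∣ S ∣
  sum-indicator []          = refl
  sum-indicator (false ∷ S) = trans (+-identityˡ _) (sum-indicator S)
  sum-indicator (true ∷ S)  = cong (λ c → 1ℤ + c) (sum-indicator S)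

  sum-matrix : ∀ {m n} (G : Vec (Subset n) m) → sum (λ u → sum λ v → matrix G u v * 1ℤ) ≡ + Vec.sum (Vec.map ∣_∣ G)
  sum-matrix []      = refl
  sum-matrix (S ∷ G) = cong₂ _+_ (sum-indicator S) (sum-matrix G)

  sum-deficiency : ∀ {n} (G : Subgraph n) k h order → sum (Deficiency.a (matrix G) k h order) ≡ (k + 1ℤ) * + n - + edges G
  sum-deficiency {n} G k h order = trans
    (sum-lin ((k + 1ℤ , one) ∷ (- 1ℤ , deg) ∷ []) (λ u → ring k (deg u)))
    (trans (cong₂ (λ m e → (k + 1ℤ) * m + (- 1ℤ * e + 0ℤ)) (sum-one n) (sum-matrix G)) (ring′ ((k + 1ℤ) * + n) (+ edges G)))
    where
    open Incidence (matrix G)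
    ring : ∀ k d → k + 1ℤ - d ≡ (k + 1ℤ) * 1ℤ + (- 1ℤ * d + 0ℤ)
    ring = solve-∀
    ring′ : ∀ m e → m + (- 1ℤ * e + 0ℤ) ≡ m - e
    ring′ = solve-∀

  pos-∸ : ∀ m n → n ℕ.≤ m → + (m ℕ.∸ n) ≡ + m - + n
  pos-∸ m n n≤m = sym (trans (m-n≡m⊖n m n) (⊖-≥ n≤m))

  -- Total deficiency is `(k + 1ℤ) * + n` minus the number of edges, and `B` is chosen so that
  -- `B + 1` edges bring it down to exactly `h * k - h - ε`.
  z≤ : ∀ {n} k h ε B (order : + n ≡ k * k + k + 1ℤ - h) →
       (∀ {x : Fin n → Fin n → ℤ} → Linear x → 0ℤ ≤ h * k - h - ε - sum (Deficiency.a x k h order) → ⊥) →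
       + B ≡ (k + 1ℤ) * + n - h * k + h + ε - 1ℤ → z n ℕ.≤ B
  z≤ {n} k h ε B order contra eq with z-attained n
  ... | G , c4free , e with edges G ℕ.≤? B
  ...   | yes e≤B = subst (ℕ._≤ B) e e≤B
  ...   | no e≰B  = ⊥-elim (contra (matrix-linear G c4free) (by slack (i≤j⇒0≤j-i (+≤+ (ℕ.≰⇒> e≰B)))))
    where
    ring : ∀ k n h ε e → e - (1ℤ + ((k + 1ℤ) * n - h * k + h + ε - 1ℤ)) ≡ h * k - h - ε - ((k + 1ℤ) * n - e)
    ring = solve-∀
    slack : + edges G - + suc B ≡ h * k - h - ε - sum (Deficiency.a (matrix G) k h order)
    slack = trans (cong (λ b → + edges G - (1ℤ + b)) eq) (trans (ring k (+ n) h ε (+ edges G)) (cong (λ c → h * k - h - ε - c) (sym (sum-deficiency G k h order))))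

  -- From integers to the bounds on z

  module _ (k : ℕ) (2≤k : 2 ℕ.≤ k) where
    K : ℤ
    K = + k

    0≤K-2 : 0ℤ ≤ K - + 2
    0≤K-2 = i≤j⇒0≤j-i (+≤+ 2≤k)

    pos-k² : + (k ℕ.^ 2) ≡ K * K
    pos-k² = trans (pos-* k (k ℕ.^ 1)) (cong (λ m → K * + m) (ℕ.*-identityʳ k))

    pos-k³+2k² : + (k ℕ.^ 3 ℕ.+ 2 ℕ.* k ℕ.^ 2) ≡ K * (K * K) + + 2 * (K * K)
    pos-k³+2k² = cong₂ _+_ (trans (pos-* k (k ℕ.^ 2)) (cong (K *_) pos-k²)) (trans (pos-* 2 (k ℕ.^ 2)) (cong (+ 2 *_) pos-k²))

    -- Here and in `bound-∸` the subtrahend does not exceed the minuend, so truncated subtraction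
    -- agrees with that of the integers.
    order : ∀ h → h ℕ.≤ 3 → + (k ℕ.^ 2 ℕ.+ k ℕ.+ 1 ℕ.∸ h) ≡ K * K + K + 1ℤ - + h
    order h h≤3 = trans (pos-∸ (k ℕ.^ 2 ℕ.+ k ℕ.+ 1) h (ℕ.≤-trans h≤3 3≤)) (cong (λ m → m + K + 1ℤ - + h) pos-k²)
      where
      3≤ : 3 ℕ.≤ k ℕ.^ 2 ℕ.+ k ℕ.+ 1
      3≤ = ℕ.+-monoˡ-≤ 1 (ℕ.≤-trans 2≤k (ℕ.m≤n+m k (k ℕ.^ 2)))

    bound-∸ : ∀ c → c ℕ.≤ 4 → + (k ℕ.^ 3 ℕ.+ 2 ℕ.* k ℕ.^ 2 ℕ.∸ c ℕ.* k) ≡ K * (K * K) + + 2 * (K * K) - + c * K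
    bound-∸ c c≤4 = trans (pos-∸ _ (c ℕ.* k) (ℕ.≤-trans (ℕ.*-monoˡ-≤ k c≤4) 4k≤)) (cong₂ _-_ pos-k³+2k² (pos-* c k))
      where
      ring : ∀ k → k * (k * k) + + 2 * (k * (k - + 2)) ≡ k * (k * k) + + 2 * (k * k) - + 4 * k
      ring = solve-∀
      4k≤ : 4 ℕ.* k ℕ.≤ k ℕ.^ 3 ℕ.+ 2 ℕ.* k ℕ.^ 2
      -- The difference is a cube plus twice `K * (K - + 2)`, nonnegative as `k` is at least 2.
      4k≤ = drop‿+≤+ (0≤i-j⇒j≤i (by (trans (ring K) (sym (cong₂ _-_ pos-k³+2k² (pos-* 4 k))))
              (0≤+ k ⊗ (0≤+ k ⊗ 0≤+ k) ⊕ 0≤+ 2 ⊗ (0≤+ k ⊗ 0≤K-2))))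

    z-bound₁ : z (k ℕ.^ 2 ℕ.+ k ℕ.+ 1 ℕ.∸ 1) ℕ.≤ k ℕ.^ 3 ℕ.+ 2 ℕ.* k ℕ.^ 2
    z-bound₁ = z≤ K (+ 1) 0ℤ _ order₁ (λ lin → ¬many-flags₁ lin K 0≤K-2 order₁)
      (trans pos-k³+2k² (trans (ring K) (cong (λ n → (K + 1ℤ) * n - + 1 * K + + 1 + 0ℤ - 1ℤ) (sym order₁))))
      where
      order₁ = order 1 (s≤s z≤n)
      ring : ∀ k → k * (k * k) + + 2 * (k * k) ≡ (k + 1ℤ) * (k * k + k + 1ℤ - + 1) - + 1 * k + + 1 + 0ℤ - 1ℤ
      ring = solve-∀

    z-bound₂ : z (k ℕ.^ 2 ℕ.+ k ℕ.+ 1 ℕ.∸ 2) ℕ.≤ k ℕ.^ 3 ℕ.+ 2 ℕ.* k ℕ.^ 2 ℕ.∸ 2 ℕ.* k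
    z-bound₂ = z≤ K (+ 2) 0ℤ _ order₂ (λ lin → ¬many-flags₂ lin K 0≤K-2 order₂)
      (trans (bound-∸ 2 (s≤s (s≤s z≤n))) (trans (ring K) (cong (λ n → (K + 1ℤ) * n - + 2 * K + + 2 + 0ℤ - 1ℤ) (sym order₂))))
      where
      order₂ = order 2 (s≤s (s≤s z≤n))
      ring : ∀ k → k * (k * k) + + 2 * (k * k) - + 2 * k ≡ (k + 1ℤ) * (k * k + k + 1ℤ - + 2) - + 2 * k + + 2 + 0ℤ - 1ℤ
      ring = solve-∀

    z-bound₃ : z (k ℕ.^ 2 ℕ.+ k ℕ.+ 1 ℕ.∸ 3) ℕ.≤ (k ℕ.^ 3 ℕ.+ 2 ℕ.* k ℕ.^ 2 ℕ.∸ 4 ℕ.* k) ℕ.+ 1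
    z-bound₃ = z≤ K (+ 3) 1ℤ _ order₃ (λ lin → ¬many-flags₃ lin K 0≤K-2 order₃)
      (trans (cong (_+ 1ℤ) (bound-∸ 4 ℕ.≤-refl)) (trans (ring K) (cong (λ n → (K + 1ℤ) * n - + 3 * K + + 3 + 1ℤ - 1ℤ) (sym order₃))))
      where
      order₃ = order 3 ℕ.≤-refl
      ring : ∀ k → k * (k * k) + + 2 * (k * k) - + 4 * k + 1ℤ ≡ (k + 1ℤ) * (k * k + k + 1ℤ - + 3) - + 3 * k + + 3 + 1ℤ - 1ℤ
      ring = solve-∀

open import Data.Nat.Base using (_+_; _*_; _∸_; _^_; _≤_)

theorem3 : (k : ℕ) → 2 ≤ k →
    (z (k ^ 2 + k + 1 ∸ 1) ≤ k ^ 3 + 2 * k ^ 2)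
    × (z (k ^ 2 + k + 1 ∸ 2) ≤ k ^ 3 + 2 * k ^ 2 ∸ 2 * k)
    × (z (k ^ 2 + k + 1 ∸ 3) ≤ (k ^ 3 + 2 * k ^ 2 ∸ 4 * k) + 1)
theorem3 k 2≤k = z-bound₁ k 2≤k , z-bound₂ k 2≤k , z-bound₃ k 2≤k
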